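{- Let $\mathsf{M}$ be a split matroid without loops and coloops, and let $T_{\mathsf{M}}(x,y)$ denote its Tutte polynomial. Then \[ T_{\mathsf{M}}(2,0)\cdot T_{\mathsf{M}}(0,2) \geq T_{\mathsf{M}}(1,1)^2.\]
   Context: A cyclic flat of a matroid is a flat that is a union of circuits. A connected split matroid is a connected matroid $\mathsf{M}$ on ground set $E$ whose proper cyclic flats form a clutter: whenever $F_1\subsetneq F_2$ are cyclic flats of $\mathsf{M}$, either $F_1=\varnothing$ or $F_2=E$. A split matroid is a matroid isomorphic to a direct sum in which exactly one summand is a connected split matroid and all remaining summands are uniform matroids. -}

module Defs where

open import Data.Nat as ℕ using (ℕ; zero; suc; _+_; _∸_; _≤_; _<_; _⊓_)
open import Data.Integer as ℤ using (ℤ)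
open import Data.Fin using (Fin)
open import Data.Fin.Subset as S using (Subset; _∈_; _∉_; _⊆_; _⊂_; _∪_; _∩_; ∁; ⁅_⁆; ∣_∣)
open import Data.Vec using (Vec; []; _∷_; take; drop; tabulate; lookup)
open import Data.Bool using (true; false)
open import Data.List using (List; []; _∷_; map; _++_)
open import Data.List.Relation.Unary.All using (All)
open import Data.Product using (Σ; ∃; _×_; proj₁; proj₂; _,_)
open import Data.Sum using (_⊎_)
open import Relation.Binary.PropositionalEquality using (_≡_; _≢_)
open import Function.Bundles using (_↔_; Inverse)

RankFn : ℕ → Set
RankFn n = Subset n → ℕ

record Matroid (n : ℕ) : Set where
  field
    rank      : RankFn n
    rank-card : ∀ A → rank A ≤ ∣ A ∣
    rank-mono : ∀ A B → A ⊆ B → rank A ≤ rank B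
    rank-sub  : ∀ A B → rank (A ∪ B) + rank (A ∩ B) ≤ rank A + rank B

module _ {n : ℕ} (M : Matroid n) where
  open Matroid M

  Independent : Subset n → Set
  Independent A = rank A ≡ ∣ A ∣

  Dependent : Subset n → Set
  Dependent A = rank A < ∣ A ∣

  Circuit : Subset n → Set
  Circuit C = Dependent C × (∀ D → D ⊂ C → Independent D)

  Flat : Subset n → Set
  Flat F = ∀ e → e ∉ F → rank F < rank (F ∪ ⁅ e ⁆)

  UnionOfCircuits : Subset n → Set
  UnionOfCircuits F = ∀ e → e ∈ F → ∃ λ C → Circuit C × C ⊆ F × e ∈ C

  CyclicFlat : Subset n → Set
  CyclicFlat F = Flat F × UnionOfCircuits F

  Connected : Set
  Connected = ∀ e f → e ≢ f → ∃ λ C → Circuit C × e ∈ C × f ∈ C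

  ConnectedSplit : Set
  ConnectedSplit = Connected ×
    (∀ F₁ F₂ → CyclicFlat F₁ → CyclicFlat F₂ → F₁ ⊂ F₂ → F₁ ≡ S.⊥ ⊎ F₂ ≡ S.⊤)

  Uniform : Set
  Uniform = ∃ λ r → ∀ A → rank A ≡ r ⊓ ∣ A ∣

  Loop : Fin n → Set
  Loop e = rank ⁅ e ⁆ ≡ 0

  Coloop : Fin n → Set
  Coloop e = rank (∁ ⁅ e ⁆) < rank S.⊤

_⊕ʳ_ : ∀ {m k} → RankFn m → RankFn k → RankFn (m + k)
(_⊕ʳ_ {m} r₁ r₂) A = r₁ (take m A) + r₂ (drop m A)

Summands : Set
Summands = List (Σ ℕ Matroid)

size : Summands → ℕ
size [] = 0
size ((k , _) ∷ L) = k + size L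

rankSum : (L : Summands) → RankFn (size L)
rankSum [] = λ _ → 0
rankSum ((k , N) ∷ L) = Matroid.rank N ⊕ʳ rankSum L

image : ∀ {n m} → Fin n ↔ Fin m → Subset n → Subset m
image σ A = tabulate (λ j → lookup A (Inverse.from σ j))

_≅ʳ_ : ∀ {n m} → Matroid n → RankFn m → Set
_≅ʳ_ {n} {m} M r = Σ (Fin n ↔ Fin m) λ σ → ∀ A → Matroid.rank M A ≡ r (image σ A)

IsSplit : ∀ {n} → Matroid n → Set
IsSplit M = Σ ℕ λ m → Σ (Matroid m) λ N → ConnectedSplit N ×
  Σ Summands λ L → All (λ p → Uniform (proj₂ p)) L ×
  (M ≅ʳ (Matroid.rank N ⊕ʳ rankSum L))

-- Tutte polynomial, evaluated at integer points:
-- T_M(x,y) = Σ_{A ⊆ E} (x-1)^{r(E)-r(A)} (y-1)^{|A|-r(A)}   (0^0 = 1)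

allSubsets : ∀ n → List (Subset n)
allSubsets zero = [] ∷ []
allSubsets (suc n) = map (true ∷_) (allSubsets n) ++ map (false ∷_) (allSubsets n)

sumℤ : List ℤ → ℤ
sumℤ [] = ℤ.0ℤ
sumℤ (z ∷ zs) = z ℤ.+ sumℤ zs

tutte : ∀ {n} → Matroid n → ℤ → ℤ → ℤ
tutte {n} M x y = sumℤ (map term (allSubsets n))
  where
  open Matroid M
  term : Subset n → ℤ
  term A = ((x ℤ.- ℤ.1ℤ) ℤ.^ (rank S.⊤ ∸ rank A)) ℤ.* ((y ℤ.- ℤ.1ℤ) ℤ.^ (∣ A ∣ ∸ rank A))

{-# OPTIONS --safe --termination-depth=2 #-}
module Submission where

open import Defs
open import Data.Bool using (Bool; true; false; not)
open import Data.Fin using (Fin; zero; suc; _↑ˡ_; _↑ʳ_; punchIn; punchOut)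
open import Data.Fin.Permutation using (Permutation; _⟨$⟩ʳ_; _⟨$⟩ˡ_; inverseˡ; inverseʳ; remove; punchIn-permute)
import Data.Fin.Properties as Fin
open import Data.Fin.Subset using (Subset; _∈_; _∉_; _⊆_; _⊂_; _∪_; _∩_; ∁; ⁅_⁆; ∣_∣; ⊥; ⊤)
open import Data.Fin.Subset.Properties
open import Data.Integer as ℤ using (ℤ; 0ℤ; 1ℤ)
import Data.Integer.Properties as ℤ
import Data.Integer.Tactic.RingSolver as ℤ
import Data.List as List
import Data.List.Properties as List
open import Data.List.Relation.Unary.All using (All; []; _∷_)
open import Data.Nat
open import Data.Nat.Properties
open import Data.Nat.Tactic.RingSolver using (solve-∀)
open import Data.Product using (∃; _×_; _,_; proj₁; proj₂)
open import Data.Sum using (_⊎_; inj₁; inj₂; [_,_]′)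
open import Data.Vec using ([]; _∷_; here; there; _[_]≔_; _++_; lookup; tabulate; take; drop; insertAt; replicate)
open import Data.Vec.Properties
open import Function using (_∘_; _↔_)
open import Relation.Binary.PropositionalEquality
open import Relation.Nullary using (¬_; Dec; does; yes; no; contradiction)
open import Relation.Nullary.Decidable using (_×-dec_; ¬?; decidable-stable; dec-true)
open import Relation.Unary using (Decidable)

-- Call a matroid elementary split if it has no minor U₀,₁ ⊕ U₁,₂ ⊕ U₁,₁; this class is closed under
-- minors and duality and contains the uniform and the connected split matroids.  The Tutte polynomial is
-- multiplicative on direct sums, so it suffices to prove the inequality for elementary split matroids
-- without loops and coloops, by induction on the size.  If some element e has no parallel and no series
-- partner, then deleting and contracting e create no loops or coloops, and the Cauchy–Schwarz inequality
-- (a + a′)(b + b′) ≥ (√ab + √a′b′)² applied to T(M) = T(M ∖ e) + T(M / e) closes the induction.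
-- Otherwise, up to duality, there is a parallel class P with at least two elements, and the excluded minor
-- forces one of three shapes: P is a direct summand; M is a circuit with one element thickened to P; or M
-- has rank 2.  In each of them T is expanded along P and the inequality becomes an elementary estimate.

-- Minors are intervals: the pair `X ⊆ Y` stands for the matroid with `X` contracted and everything
-- outside `Y` deleted. Contraction and deletion move one end of the interval, duality complements
-- and swaps the ends, and the rank function stays the same. The plain induction is obstructed
-- because contracting an element turns its parallel partners into loops and deleting it turns its
-- series partners into coloops. The inequality fails there: a single coloop has `T = x`, and 2 * 0
-- < 1. When partners are unavoidable, the key fact is that a parallel class `P` of size at least
-- two is dependent, so over `P` every loopless nonspanning set is free. If a series pair lies
-- outside `P`, removing it leaves a nonspanning set; freeness then pins the contraction by `P` down
-- to a circuit. If instead only parallel pairs lie outside `P`, such a pair stays parallel after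
-- contracting `P`, which caps the rank at 2. The estimates have no slack in the smallest cases, so
-- small sizes have to be excluded structurally.

private variable
  m n : ℕ
  x y : Fin n
  W X Y : Subset n

-- Subsets

add del : Fin n → Subset n → Subset n
add x X = X [ x ]≔ true
del x X = X [ x ]≔ false

x∈add : ∀ x (X : Subset n) → x ∈ add x X
x∈add x X = []≔-updates X x

∈-add : ∀ x → y ∈ X → y ∈ add x X
∈-add {y = y} {X} x y∈X with y Fin.≟ x
... | yes refl = x∈add x X
... | no y≢x = []≔-minimal X y x y≢x y∈X

add⁻ : ∀ x (X : Subset n) → y ∈ add x X → y ≡ x ⊎ y ∈ X
add⁻ zero (_ ∷ X) here = inj₁ refl
add⁻ zero (_ ∷ X) (there h) = inj₂ (there h)
add⁻ (suc x) (_ ∷ X) here = inj₂ here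
add⁻ (suc x) (_ ∷ X) (there h) with add⁻ x X h
... | inj₁ refl = inj₁ refl
... | inj₂ h′ = inj₂ (there h′)

del⁻ : ∀ x (X : Subset n) → y ∈ del x X → y ∈ X
del⁻ zero (_ ∷ X) (there h) = there h
del⁻ (suc x) (_ ∷ X) here = here
del⁻ (suc x) (_ ∷ X) (there h) = there (del⁻ x X h)

x∉del : ∀ x (X : Subset n) → x ∉ del x X
x∉del (suc x) (_ ∷ X) (there h) = x∉del x X h

∈-del : y ≢ x → y ∈ X → y ∈ del x X
∈-del {y = y} {x = x} {X = X} y≢x h = []≔-minimal X y x y≢x h

∈del⇒≢ : ∀ (X : Subset n) → y ∈ del x X → y ≢ x
∈del⇒≢ X h refl = x∉del _ X h

∉-del : ∀ x → y ∉ X → y ∉ del x X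
∉-del {X = X} x y∉X = y∉X ∘ del⁻ x X

∉-add : y ≢ x → y ∉ X → y ∉ add x X
∉-add {X = X} y≢x y∉X h with add⁻ _ X h
... | inj₁ y≡x = y≢x y≡x
... | inj₂ y∈X = y∉X y∈X

∉⇒lookup : ∀ (X : Subset n) x → x ∉ X → lookup X x ≡ false
∉⇒lookup (true ∷ X) zero h = contradiction here h
∉⇒lookup (false ∷ X) zero h = refl
∉⇒lookup (_ ∷ X) (suc x) h = ∉⇒lookup X x (h ∘ there)

add-∈ : x ∈ X → add x X ≡ X
add-∈ {x = x} {X} h = trans (cong (X [ x ]≔_) (sym ([]=⇒lookup h))) ([]≔-lookup X x)

del-∉ : x ∉ X → del x X ≡ X
del-∉ {x = x} {X} h = trans (cong (X [ x ]≔_) (sym (∉⇒lookup X x h))) ([]≔-lookup X x)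

add-del : x ∈ X → add x (del x X) ≡ X
add-del {x = x} {X} h = trans ([]≔-idempotent X x) (add-∈ h)

del-add : x ∉ X → del x (add x X) ≡ X
del-add {x = x} {X} h = trans ([]≔-idempotent X x) (del-∉ h)

add-comm : ∀ x y (X : Subset n) → add x (add y X) ≡ add y (add x X)
add-comm x y X with x Fin.≟ y
... | yes refl = refl
... | no x≢y = []≔-commutes X y x (x≢y ∘ sym)

add-del-comm : ∀ (X : Subset n) → x ≢ y → add x (del y X) ≡ del y (add x X)
add-del-comm X x≢y = []≔-commutes X _ _ (x≢y ∘ sym)

∁-add : ∀ x (X : Subset n) → ∁ (add x X) ≡ del x (∁ X)
∁-add x X = map-[]≔ not X x

∁-del : ∀ x (X : Subset n) → ∁ (del x X) ≡ add x (∁ X)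
∁-del x X = map-[]≔ not X x

∁-involutive : ∀ (X : Subset n) → ∁ (∁ X) ≡ X
∁-involutive [] = refl
∁-involutive (true ∷ X) = cong (true ∷_) (∁-involutive X)
∁-involutive (false ∷ X) = cong (false ∷_) (∁-involutive X)

∣add∣ : x ∉ X → ∣ add x X ∣ ≡ suc ∣ X ∣
∣add∣ {x = zero} {true ∷ X} h = contradiction here h
∣add∣ {x = zero} {false ∷ X} h = refl
∣add∣ {x = suc x} {true ∷ X} h = cong suc (∣add∣ (h ∘ there))
∣add∣ {x = suc x} {false ∷ X} h = ∣add∣ (h ∘ there)

∣del∣ : x ∈ X → ∣ X ∣ ≡ suc ∣ del x X ∣
∣del∣ {x = x} {X} h = trans (cong ∣_∣ (sym (add-del h))) (∣add∣ (x∉del x X))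

∣∁∣ : ∀ (X : Subset n) → ∣ X ∣ + ∣ ∁ X ∣ ≡ n
∣∁∣ X = trans (cong (∣ X ∣ +_) (∣∁p∣≡n∸∣p∣ X)) (m+[n∸m]≡n (∣p∣≤n X))

⊆-add : ∀ x (X : Subset n) → X ⊆ add x X
⊆-add x X = ∈-add x

add-⊆ : x ∈ Y → X ⊆ Y → add x X ⊆ Y
add-⊆ {X = X} x∈Y X⊆Y h with add⁻ _ X h
... | inj₁ refl = x∈Y
... | inj₂ h′ = X⊆Y h′

⊆-del : x ∉ X → X ⊆ Y → X ⊆ del x Y
⊆-del x∉X X⊆Y h = ∈-del (λ { refl → x∉X h }) (X⊆Y h)

del-⊆ : ∀ x (X : Subset n) → del x X ⊆ X
del-⊆ x X = del⁻ x X

∪⁅⁆≡add : ∀ x (X : Subset n) → X ∪ ⁅ x ⁆ ≡ add x X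
∪⁅⁆≡add zero (true ∷ X) = cong (true ∷_) (∪-identityʳ X)
∪⁅⁆≡add zero (false ∷ X) = cong (true ∷_) (∪-identityʳ X)
∪⁅⁆≡add (suc x) (true ∷ X) = cong (true ∷_) (∪⁅⁆≡add x X)
∪⁅⁆≡add (suc x) (false ∷ X) = cong (false ∷_) (∪⁅⁆≡add x X)

⊆⇒≡⊎∃ : ∀ (X Y : Subset n) → X ⊆ Y → X ≡ Y ⊎ ∃ λ x → x ∈ Y × x ∉ X
⊆⇒≡⊎∃ X Y X⊆Y with Fin.any? (λ x → (x ∈? Y) ×-dec ¬? (x ∈? X))
... | yes p = inj₂ p
... | no ¬p = inj₁ (⊆-antisym X⊆Y (λ {x} x∈Y → decidable-stable (x ∈? X) (λ x∉X → ¬p (x , x∈Y , x∉X))))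

-- Induction along a chain from `X` to `Y`. The recursion completes the tail before the head, so
-- each intermediate set lies between `X` and `Y`.
grow : ∀ (X Y : Subset n) (P : Subset n → Set) → X ⊆ Y →
       (∀ x W → X ⊆ W → W ⊆ Y → x ∈ Y → x ∉ W → P W → P (add x W)) → P X → P Y
grow [] [] P X⊆Y step PX = PX
grow (b ∷ X) (c ∷ Y) P X⊆Y step PX = head b c X⊆Y step
  (grow X Y (P ∘ (b ∷_)) (drop-∷-⊆ X⊆Y)
    (λ x W X⊆W W⊆Y x∈Y x∉W → step (suc x) (b ∷ W) (s⊆s X⊆W) (lift b c X⊆Y W⊆Y) (there x∈Y) (λ { (there h) → x∉W h }))
    PX)
  where
  lift : ∀ b c {X Y W} → b ∷ X ⊆ c ∷ Y → W ⊆ Y → b ∷ W ⊆ c ∷ Y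
  lift true true h W⊆Y = s⊆s W⊆Y
  lift true false h W⊆Y = λ { here → contradiction (h here) λ () ; (there i) → there (W⊆Y i) }
  lift false c h W⊆Y = out⊆ W⊆Y
  head : ∀ b c → b ∷ X ⊆ c ∷ Y →
    (∀ x W → b ∷ X ⊆ W → W ⊆ c ∷ Y → x ∈ c ∷ Y → x ∉ W → P W → P (add x W)) → P (b ∷ Y) → P (c ∷ Y)
  head true true _ _ p = p
  head false false _ _ p = p
  head true false h _ p = contradiction (h here) λ ()
  head false true h step p = step zero (false ∷ Y) (s⊆s (drop-∷-⊆ h)) (out⊆ (λ i → i)) here (λ ()) p

-- Rank functions and duality

-- A rank function up to an additive constant; with this freedom X ↦ ∣ X ∣ + r (∁ X) is a dual of r.
record Rank (n : ℕ) : Set where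
  field
    r : Subset n → ℕ
    r-≤-add : ∀ x X → r X ≤ r (add x X)
    r-add-≤ : ∀ x X → r (add x X) ≤ suc (r X)
    r-diminishing : ∀ x {X Y} → X ⊆ Y → r (add x Y) + r X ≤ r (add x X) + r Y

module RankTheory {n : ℕ} (R : Rank n) where
  open Rank R public

  r-mono : X ⊆ Y → r X ≤ r Y
  r-mono {X} {Y} X⊆Y = grow X Y (λ W → r X ≤ r W) X⊆Y
    (λ x W _ _ _ _ h → ≤-trans h (r-≤-add x W)) ≤-refl

  r-card : X ⊆ Y → r Y + ∣ X ∣ ≤ r X + ∣ Y ∣
  r-card {X} {Y} X⊆Y = grow X Y (λ W → r W + ∣ X ∣ ≤ r X + ∣ W ∣) X⊆Y step ≤-refl
    where
    open ≤-Reasoning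
    step : ∀ x W → X ⊆ W → W ⊆ Y → x ∈ Y → x ∉ W → r W + ∣ X ∣ ≤ r X + ∣ W ∣ → r (add x W) + ∣ X ∣ ≤ r X + ∣ add x W ∣
    step x W _ _ _ x∉W h = begin
      r (add x W) + ∣ X ∣ ≤⟨ +-monoˡ-≤ ∣ X ∣ (r-add-≤ x W) ⟩
      suc (r W + ∣ X ∣)   ≤⟨ s≤s h ⟩
      suc (r X + ∣ W ∣)   ≡⟨ +-suc (r X) ∣ W ∣ ⟨
      r X + suc ∣ W ∣     ≡⟨ cong (r X +_) (∣add∣ x∉W) ⟨
      r X + ∣ add x W ∣   ∎

  add-dichotomy : ∀ x X → r (add x X) ≡ r X ⊎ r (add x X) ≡ suc (r X)
  add-dichotomy x X with m≤n⇒m<n∨m≡n (r-≤-add x X)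
  ... | inj₁ < = inj₂ (≤-antisym (r-add-≤ x X) <)
  ... | inj₂ ≡ = inj₁ (sym ≡)

  del-dichotomy : ∀ Y → x ∈ Y → r (del x Y) ≡ r Y ⊎ r Y ≡ suc (r (del x Y))
  del-dichotomy {x} Y x∈Y with add-dichotomy x (del x Y)
  ... | inj₁ p rewrite add-del x∈Y = inj₁ (sym p)
  ... | inj₂ p rewrite add-del x∈Y = inj₂ p

  r-del-≤ : ∀ x Y → r (del x Y) ≤ r Y
  r-del-≤ x Y = r-mono (del-⊆ x Y)

  -- By diminishing returns the gain of `x` over `Y` is at most its gain over `X`, which is zero.
  loop-⊆ : X ⊆ Y → r (add x X) ≡ r X → r (add x Y) ≡ r Y
  loop-⊆ {X} {Y} {x} X⊆Y p = ≤-antisym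
    (+-cancelʳ-≤ (r X) _ _ (≤-trans (r-diminishing x X⊆Y) (≤-reflexive (trans (cong (_+ r Y) p) (+-comm (r X) (r Y))))))
    (r-≤-add x Y)

  nonloop-⊆ : X ⊆ Y → r (add x Y) ≡ suc (r Y) → r (add x X) ≡ suc (r X)
  nonloop-⊆ {X} {Y} {x} X⊆Y p with add-dichotomy x X
  ... | inj₁ q = contradiction (trans (sym p) (loop-⊆ X⊆Y q)) 1+n≢n
  ... | inj₂ q = q

  coloop⇒add : x ∈ Y → r Y ≡ suc (r (del x Y)) → W ⊆ del x Y → r (add x W) ≡ suc (r W)
  coloop⇒add {x} {Y} x∈Y p W⊆ = nonloop-⊆ W⊆ (trans (cong r (add-del x∈Y)) p)

  noncoloop : x ∈ Y → W ⊆ del x Y → r (add x W) ≡ r W → r (del x Y) ≡ r Y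
  noncoloop {x} {Y} x∈Y W⊆ p = trans (sym (loop-⊆ W⊆ p)) (cong r (add-del x∈Y))

  nonloop : r (add x X) ≢ r X → r (add x X) ≡ suc (r X)
  nonloop {x} {X} h with add-dichotomy x X
  ... | inj₁ p = contradiction p h
  ... | inj₂ p = p

  closure-rank : W ⊆ Y → (∀ x → x ∈ Y → r (add x W) ≡ r W) → r Y ≡ r W
  closure-rank {W} {Y} W⊆Y h = grow W Y (λ V → r V ≡ r W) W⊆Y
    (λ x V W⊆V _ x∈Y _ p → trans (loop-⊆ W⊆V (h x x∈Y)) p) refl

  -- If every element of `X` were a coloop of `X`, building `X` up from `⊥` would gain one at each
  -- step, and the rank would be maximal.
  dependent⇒∃ : ∀ X → r X < ∣ X ∣ + r ⊥ → ∃ λ x → x ∈ X × r (del x X) ≡ r X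
  dependent⇒∃ X lt with Fin.any? (λ x → (x ∈? X) ×-dec (r (del x X) ≟ r X))
  ... | yes p = p
  ... | no ¬p = contradiction (subst (r X <_) (sym free) lt) (<-irrefl refl)
    where
    step : ∀ x W → ⊥ ⊆ W → W ⊆ X → x ∈ X → x ∉ W → r W ≡ ∣ W ∣ + r ⊥ → r (add x W) ≡ ∣ add x W ∣ + r ⊥
    step x W _ W⊆X x∈X x∉W p with del-dichotomy X x∈X
    ... | inj₁ q = contradiction (x , x∈X , q) ¬p
    ... | inj₂ q = trans (coloop⇒add x∈X q (⊆-del x∉W W⊆X)) (trans (cong suc p) (cong (_+ r ⊥) (sym (∣add∣ x∉W))))
    free : r X ≡ ∣ X ∣ + r ⊥
    free = grow ⊥ X (λ W → r W ≡ ∣ W ∣ + r ⊥) (⊆-min X) step (sym (cong (_+ r ⊥) (∣⊥∣≡0 n)))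

dual : Rank n → Rank n
dual R = record
  { r = λ X → ∣ X ∣ + r (∁ X)
  ; r-≤-add = up
  ; r-add-≤ = down
  ; r-diminishing = dim
  }
  where
  open RankTheory R
  up : ∀ x X → ∣ X ∣ + r (∁ X) ≤ ∣ add x X ∣ + r (∁ (add x X))
  up x X with x ∈? X
  ... | yes x∈X rewrite add-∈ x∈X = ≤-refl
  ... | no x∉X rewrite ∣add∣ x∉X | ∁-add x X with del-dichotomy (∁ X) (x∉p⇒x∈∁p x∉X)
  ...   | inj₁ p rewrite p = n≤1+n _
  ...   | inj₂ p rewrite p = ≤-reflexive (+-suc ∣ X ∣ _)
  down : ∀ x X → ∣ add x X ∣ + r (∁ (add x X)) ≤ suc (∣ X ∣ + r (∁ X))
  down x X with x ∈? X
  ... | yes x∈X rewrite add-∈ x∈X = n≤1+n _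
  ... | no x∉X rewrite ∣add∣ x∉X | ∁-add x X = s≤s (+-monoʳ-≤ ∣ X ∣ (r-del-≤ x (∁ X)))
  dim : ∀ x {X Y} → X ⊆ Y →
    (∣ add x Y ∣ + r (∁ (add x Y))) + (∣ X ∣ + r (∁ X)) ≤ (∣ add x X ∣ + r (∁ (add x X))) + (∣ Y ∣ + r (∁ Y))
  dim x {X} {Y} X⊆Y with x ∈? Y | x ∈? X
  ... | yes x∈Y | yes x∈X rewrite add-∈ x∈X | add-∈ x∈Y = ≤-reflexive (+-comm (∣ Y ∣ + r (∁ Y)) _)
  ... | yes x∈Y | no x∉X rewrite add-∈ x∈Y = ≤-trans (+-monoʳ-≤ (∣ Y ∣ + r (∁ Y)) (up x X)) (≤-reflexive (+-comm (∣ Y ∣ + r (∁ Y)) _))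
  ... | no x∉Y | yes x∈X = contradiction (X⊆Y x∈X) x∉Y
  -- Diminishing returns of `r` for `∁ Y - x ⊆ ∁ X - x`, with `x` added back on both sides.
  ... | no x∉Y | no x∉X rewrite ∣add∣ x∉X | ∣add∣ x∉Y | ∁-add x X | ∁-add x Y =
    lemma ∣ Y ∣ ∣ X ∣ (r (del x (∁ Y))) (r (∁ X)) (r (del x (∁ X))) (r (∁ Y))
      (subst₂ _≤_ (cong (λ Z → r Z + r (del x (∁ Y))) (add-del (x∉p⇒x∈∁p x∉X)))
        (cong (λ Z → r Z + r (del x (∁ X))) (add-del (x∉p⇒x∈∁p x∉Y)))
        (r-diminishing x (⊆-del (x∉del x (∁ Y)) (λ h → p⊆q⇒∁p⊇∁q X⊆Y (del⁻ x (∁ Y) h)))))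
    where
    lemma : ∀ a b p q s t → q + p ≤ t + s → suc a + p + (b + q) ≤ suc b + s + (a + t)
    lemma a b p q s t h = subst₂ _≤_ (e₁ a b p q) (e₂ a b s t) (+-monoʳ-≤ (suc (a + b)) h)
      where
      e₁ : ∀ a b p q → suc (a + b) + (q + p) ≡ suc a + p + (b + q)
      e₁ = solve-∀
      e₂ : ∀ a b s t → suc (a + b) + (t + s) ≡ suc b + s + (a + t)
      e₂ = solve-∀

-- Tutte polynomials of minors

-- The sum of f over the interval { A ∣ X ⊆ A ⊆ Y }; a junk value unless X ⊆ Y.
∑ : Subset n → Subset n → (Subset n → ℤ) → ℤ
∑ [] [] f = f []
∑ (b ∷ X) (false ∷ Y) f = ∑ X Y (f ∘ (false ∷_))
∑ (true ∷ X) (true ∷ Y) f = ∑ X Y (f ∘ (true ∷_))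
∑ (false ∷ X) (true ∷ Y) f = ∑ X Y (f ∘ (true ∷_)) ℤ.+ ∑ X Y (f ∘ (false ∷_))

∑-cong : ∀ {X Y : Subset n} {f g} → X ⊆ Y → (∀ A → X ⊆ A → A ⊆ Y → f A ≡ g A) → ∑ X Y f ≡ ∑ X Y g
∑-cong {X = []} {[]} X⊆Y h = h [] (λ i → i) (λ i → i)
∑-cong {X = true ∷ X} {false ∷ Y} X⊆Y h = contradiction (X⊆Y here) λ ()
∑-cong {X = false ∷ X} {false ∷ Y} X⊆Y h = ∑-cong (drop-∷-⊆ X⊆Y) (λ A p q → h (false ∷ A) (s⊆s p) (s⊆s q))
∑-cong {X = true ∷ X} {true ∷ Y} X⊆Y h = ∑-cong (drop-∷-⊆ X⊆Y) (λ A p q → h (true ∷ A) (s⊆s p) (s⊆s q))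
∑-cong {X = false ∷ X} {true ∷ Y} X⊆Y h = cong₂ ℤ._+_
  (∑-cong (drop-∷-⊆ X⊆Y) (λ A p q → h (true ∷ A) (out⊆ p) (s⊆s q)))
  (∑-cong (drop-∷-⊆ X⊆Y) (λ A p q → h (false ∷ A) (s⊆s p) (out⊆ q)))

∑-*ˡ : ∀ (X Y : Subset n) k f → ∑ X Y (λ A → k ℤ.* f A) ≡ k ℤ.* ∑ X Y f
∑-*ˡ [] [] k f = refl
∑-*ˡ (b ∷ X) (false ∷ Y) k f = ∑-*ˡ X Y k _
∑-*ˡ (true ∷ X) (true ∷ Y) k f = ∑-*ˡ X Y k _
∑-*ˡ (false ∷ X) (true ∷ Y) k f = trans (cong₂ ℤ._+_ (∑-*ˡ X Y k _) (∑-*ˡ X Y k _)) (sym (ℤ.*-distribˡ-+ k _ _))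

∑-singleton : ∀ (X : Subset n) f → ∑ X X f ≡ f X
∑-singleton [] f = refl
∑-singleton (true ∷ X) f = ∑-singleton X _
∑-singleton (false ∷ X) f = ∑-singleton X _

∑-split : ∀ x {X Y : Subset n} f → x ∈ Y → x ∉ X → ∑ X Y f ≡ ∑ (add x X) Y f ℤ.+ ∑ X (del x Y) f
∑-split zero {true ∷ X} f here x∉X = contradiction here x∉X
∑-split zero {false ∷ X} f here x∉X = refl
∑-split (suc x) {b ∷ X} {false ∷ Y} f (there x∈Y) x∉X = ∑-split x _ x∈Y (x∉X ∘ there)
∑-split (suc x) {true ∷ X} {true ∷ Y} f (there x∈Y) x∉X = ∑-split x _ x∈Y (x∉X ∘ there)
∑-split (suc x) {false ∷ X} {true ∷ Y} f (there x∈Y) x∉X =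
  trans (cong₂ ℤ._+_ (∑-split x _ x∈Y (x∉X ∘ there)) (∑-split x _ x∈Y (x∉X ∘ there))) (interchange (∑ (add x X) Y (f ∘ (true ∷_))) _ (∑ (add x X) Y (f ∘ (false ∷_))) _)
  where
  interchange : ∀ a b c d → (a ℤ.+ b) ℤ.+ (c ℤ.+ d) ≡ (a ℤ.+ c) ℤ.+ (b ℤ.+ d)
  interchange = ℤ.solve-∀

∑-shift : ∀ x {X Y : Subset n} f → x ∈ Y → x ∉ X → ∑ (add x X) Y f ≡ ∑ X (del x Y) (f ∘ add x)
∑-shift zero {true ∷ X} f here x∉X = contradiction here x∉X
∑-shift zero {false ∷ X} f here x∉X = refl
∑-shift (suc x) {b ∷ X} {false ∷ Y} f (there x∈Y) x∉X = ∑-shift x _ x∈Y (x∉X ∘ there)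
∑-shift (suc x) {true ∷ X} {true ∷ Y} f (there x∈Y) x∉X = ∑-shift x _ x∈Y (x∉X ∘ there)
∑-shift (suc x) {false ∷ X} {true ∷ Y} f (there x∈Y) x∉X =
  cong₂ ℤ._+_ (∑-shift x _ x∈Y (x∉X ∘ there)) (∑-shift x _ x∈Y (x∉X ∘ there))

∑-∁ : ∀ {X Y : Subset n} f → X ⊆ Y → ∑ X Y f ≡ ∑ (∁ Y) (∁ X) (f ∘ ∁)
∑-∁ {X = []} {[]} f X⊆Y = refl
∑-∁ {X = true ∷ X} {false ∷ Y} f X⊆Y = contradiction (X⊆Y here) λ ()
∑-∁ {X = false ∷ X} {false ∷ Y} f X⊆Y = ∑-∁ _ (drop-∷-⊆ X⊆Y)
∑-∁ {X = true ∷ X} {true ∷ Y} f X⊆Y = ∑-∁ _ (drop-∷-⊆ X⊆Y)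
∑-∁ {X = false ∷ X} {true ∷ Y} f X⊆Y = trans (ℤ.+-comm (∑ X Y (f ∘ (true ∷_))) _)
  (cong₂ ℤ._+_ (∑-∁ _ (drop-∷-⊆ X⊆Y)) (∑-∁ _ (drop-∷-⊆ X⊆Y)))

m≡n+o⇒m∸n≡o : ∀ {m o} n → m ≡ n + o → m ∸ n ≡ o
m≡n+o⇒m∸n≡o {o = o} n refl = m+n∸m≡n n o

module Tutte {n : ℕ} (R : Rank n) where
  open RankTheory R

  -- The Tutte polynomial at (u + 1, v + 1) of the minor obtained by restricting to Y and contracting X.
  term : ℤ → ℤ → Subset n → Subset n → Subset n → ℤ
  term u v X Y A = u ℤ.^ (r Y ∸ r A) ℤ.* v ℤ.^ ((∣ A ∣ + r X) ∸ (∣ X ∣ + r A))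

  T : ℤ → ℤ → Subset n → Subset n → ℤ
  T u v X Y = ∑ X Y (term u v X Y)

  T-empty : ∀ u v X → T u v X X ≡ 1ℤ
  T-empty u v X rewrite ∑-singleton X (term u v X X) | n∸n≡0 (r X) | n∸n≡0 (∣ X ∣ + r X) = refl

  module _ (u v : ℤ) {x : Fin n} {X Y : Subset n} (X⊆Y : X ⊆ Y) (x∈Y : x ∈ Y) (x∉X : x ∉ X) where

    -- One formula for all kinds of elements: the exponent of `v` is 1 if `x` is a loop of the minor
    -- and 0 otherwise, and the exponent of `u` is 1 if `x` is a coloop and 0 otherwise.
    T-split : T u v X Y ≡ v ℤ.^ (suc (r X) ∸ r (add x X)) ℤ.* T u v (add x X) Y
                          ℤ.+ u ℤ.^ (r Y ∸ r (del x Y)) ℤ.* T u v X (del x Y)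
    T-split = trans (∑-split x (term u v X Y) x∈Y x∉X) (cong₂ ℤ._+_
      (trans (∑-cong (add-⊆ x∈Y X⊆Y) contracted) (∑-*ˡ (add x X) Y (v ℤ.^ (suc (r X) ∸ r (add x X))) (term u v (add x X) Y)))
      (trans (∑-cong (⊆-del x∉X X⊆Y) deleted) (∑-*ˡ X (del x Y) (u ℤ.^ (r Y ∸ r (del x Y))) (term u v X (del x Y)))))
      where
      nullity : ∀ {A} → add x X ⊆ A → (∣ A ∣ + r X) ∸ (∣ X ∣ + r A)
        ≡ (suc (r X) ∸ r (add x X)) + ((∣ A ∣ + r (add x X)) ∸ (∣ add x X ∣ + r A))
      -- Adding `suc (r (add x X))` to both sides clears the truncated differences.
      nullity {A} A⊇ = m≡n+o⇒m∸n≡o (∣ X ∣ + r A) (+-cancelʳ-≡ (suc (r (add x X))) _ _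
        (eq (∣ A ∣) (r X) (∣ X ∣) (r A) (r (add x X)) _ _
          (m+[n∸m]≡n (r-add-≤ x X))
          (m+[n∸m]≡n (subst₂ _≤_ (+-comm (r A) _) (+-comm (r (add x X)) _) (r-card A⊇)))
          (∣add∣ x∉X)))
        where
        eq : ∀ a rx cx ra rx′ d w {cx′} → rx′ + d ≡ suc rx → cx′ + ra + w ≡ a + rx′ → cx′ ≡ suc cx →
          a + rx + suc rx′ ≡ cx + ra + (d + w) + suc rx′
        eq a rx cx ra rx′ d w p q refl = begin
          a + rx + suc rx′                  ≡⟨ e₁ a rx rx′ ⟩
          (a + rx′) + suc rx                ≡⟨ cong₂ _+_ q p ⟨
          (suc cx + ra + w) + (rx′ + d)     ≡⟨ e₂ cx ra w rx′ d ⟩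
          cx + ra + (d + w) + suc rx′ ∎
          where
          open ≡-Reasoning
          e₁ : ∀ a rx rx′ → a + rx + suc rx′ ≡ (a + rx′) + suc rx
          e₁ = solve-∀
          e₂ : ∀ cx ra w rx′ d → (suc cx + ra + w) + (rx′ + d) ≡ cx + ra + (d + w) + suc rx′
          e₂ = solve-∀
      contracted : ∀ A → add x X ⊆ A → A ⊆ Y →
        term u v X Y A ≡ v ℤ.^ (suc (r X) ∸ r (add x X)) ℤ.* term u v (add x X) Y A
      contracted A A⊇ _ = trans
        (cong (u ℤ.^ (r Y ∸ r A) ℤ.*_) (trans (cong (v ℤ.^_) (nullity A⊇)) (ℤ.^-distribˡ-+-* v (suc (r X) ∸ r (add x X)) _)))
        (swap (u ℤ.^ (r Y ∸ r A)) (v ℤ.^ (suc (r X) ∸ r (add x X))) _)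
        where
        swap : ∀ a b c → a ℤ.* (b ℤ.* c) ≡ b ℤ.* (a ℤ.* c)
        swap = ℤ.solve-∀
      deleted : ∀ A → X ⊆ A → A ⊆ del x Y →
        term u v X Y A ≡ u ℤ.^ (r Y ∸ r (del x Y)) ℤ.* term u v X (del x Y) A
      deleted A _ A⊆ = trans
        (cong (ℤ._* v ℤ.^ ((∣ A ∣ + r X) ∸ (∣ X ∣ + r A)))
          (trans (cong (u ℤ.^_) (m≡n+o⇒m∸n≡o (r A) corank)) (ℤ.^-distribˡ-+-* u (r Y ∸ r (del x Y)) _)))
        (ℤ.*-assoc (u ℤ.^ (r Y ∸ r (del x Y))) _ _)
        where
        corank : r Y ≡ r A + ((r Y ∸ r (del x Y)) + (r (del x Y) ∸ r A))
        corank = begin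
          r Y                                                     ≡⟨ m∸n+n≡m (r-del-≤ x Y) ⟨
          (r Y ∸ r (del x Y)) + r (del x Y)                       ≡⟨ cong ((r Y ∸ r (del x Y)) +_) (m+[n∸m]≡n (r-mono A⊆)) ⟨
          (r Y ∸ r (del x Y)) + (r A + (r (del x Y) ∸ r A))       ≡⟨ e (r A) (r Y ∸ r (del x Y)) _ ⟩
          r A + ((r Y ∸ r (del x Y)) + (r (del x Y) ∸ r A))       ∎
          where
          open ≡-Reasoning
          e : ∀ a b c → b + (a + c) ≡ a + (b + c)
          e = solve-∀

    -- A loop or coloop raises the rank of every set of the interval by the same amount.
    T-separator : ∀ d → (∀ A → X ⊆ A → A ⊆ del x Y → r (add x A) ≡ d + r A) →
                  T u v (add x X) Y ≡ T u v X (del x Y)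
    T-separator d h = trans (∑-shift x (term u v (add x X) Y) x∈Y x∉X) (∑-cong (⊆-del x∉X X⊆Y) same)
      where
      X⊆ : X ⊆ del x Y
      X⊆ = ⊆-del x∉X X⊆Y
      same : ∀ A → X ⊆ A → A ⊆ del x Y → term u v (add x X) Y (add x A) ≡ term u v X (del x Y) A
      same A X⊆A A⊆ = cong₂ (λ p q → u ℤ.^ p ℤ.* v ℤ.^ q)
        (trans (cong₂ _∸_ (trans (cong r (sym (add-del x∈Y))) (h (del x Y) X⊆ (λ i → i))) (h A X⊆A A⊆)) ([m+n]∸[m+o]≡n∸o d _ _))
        (trans (cong₂ _∸_
          (trans (cong₂ _+_ (∣add∣ (λ i → x∉del x Y (A⊆ i))) (h X (λ i → i) X⊆)) (e d ∣ A ∣ (r X)))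
          (trans (cong₂ _+_ (∣add∣ x∉X) (h A X⊆A A⊆)) (e d ∣ X ∣ (r A))))
          ([m+n]∸[m+o]≡n∸o (suc d) _ _))
        where
        e : ∀ d a b → suc a + (d + b) ≡ suc d + (a + b)
        e = solve-∀

    T-loop-eq : r (add x X) ≡ r X → T u v (add x X) Y ≡ T u v X (del x Y)
    T-loop-eq p = T-separator 0 (λ A X⊆A _ → loop-⊆ X⊆A p)

    T-coloop-eq : r Y ≡ suc (r (del x Y)) → T u v (add x X) Y ≡ T u v X (del x Y)
    T-coloop-eq p = T-separator 1 (λ A _ A⊆ → coloop⇒add x∈Y p A⊆)

    T-loop : r (add x X) ≡ r X → T u v X Y ≡ (v ℤ.+ 1ℤ) ℤ.* T u v (add x X) Y
    T-loop p = trans T-split (trans (cong₂ ℤ._+_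
        (cong (λ k → v ℤ.^ k ℤ.* T u v (add x X) Y) (trans (cong (suc (r X) ∸_) p) (m≡n+o⇒m∸n≡o (r X) (sym (+-comm (r X) 1)))))
        (cong₂ (λ k t → u ℤ.^ k ℤ.* t) (trans (cong (r Y ∸_) (noncoloop x∈Y (⊆-del x∉X X⊆Y) p)) (n∸n≡0 (r Y))) (sym (T-loop-eq p))))
      (e v (T u v (add x X) Y)))
      where
      e : ∀ v t → (v ℤ.* 1ℤ) ℤ.* t ℤ.+ 1ℤ ℤ.* t ≡ (v ℤ.+ 1ℤ) ℤ.* t
      e = ℤ.solve-∀

    T-coloop : r Y ≡ suc (r (del x Y)) → T u v X Y ≡ (u ℤ.+ 1ℤ) ℤ.* T u v X (del x Y)
    T-coloop p = trans T-split (trans (cong₂ ℤ._+_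
        (cong₂ (λ k t → v ℤ.^ k ℤ.* t) (trans (cong (suc (r X) ∸_) (coloop⇒add x∈Y p (⊆-del x∉X X⊆Y))) (n∸n≡0 (r X))) (T-coloop-eq p))
        (cong (λ k → u ℤ.^ k ℤ.* T u v X (del x Y)) (trans (cong (_∸ r (del x Y)) p) (m≡n+o⇒m∸n≡o (r (del x Y)) (sym (+-comm (r (del x Y)) 1))))))
      (e u (T u v X (del x Y))))
      where
      e : ∀ u t → 1ℤ ℤ.* t ℤ.+ (u ℤ.* 1ℤ) ℤ.* t ≡ (u ℤ.+ 1ℤ) ℤ.* t
      e = ℤ.solve-∀

    T-delcon : r (add x X) ≡ suc (r X) → r (del x Y) ≡ r Y → T u v X Y ≡ T u v (add x X) Y ℤ.+ T u v X (del x Y)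
    T-delcon p q = trans T-split (cong₂ ℤ._+_
      (trans (cong (λ k → v ℤ.^ k ℤ.* T u v (add x X) Y) (trans (cong (suc (r X) ∸_) p) (n∸n≡0 (r X)))) (ℤ.*-identityˡ _))
      (trans (cong (λ k → u ℤ.^ k ℤ.* T u v X (del x Y)) (trans (cong (r Y ∸_) q) (n∸n≡0 (r Y)))) (ℤ.*-identityˡ _)))

  module _ (x y : ℕ) where
    private
      u v : ℤ
      u = ℤ.+ x ℤ.- 1ℤ
      v = ℤ.+ y ℤ.- 1ℤ
      -1+1 : ∀ k → k ℤ.- 1ℤ ℤ.+ 1ℤ ≡ k
      -1+1 = ℤ.solve-∀

    -- At `x = 0` or `y = 0` the summands carry signs, so the sum is not visibly nonnegative.
    -- Deletion and contraction express it with the coefficients `x`, `y` and 1, all natural. This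
    -- moves the induction from integers to `ℕ`.
    T-nonNegative : ∀ N {X Y} → X ⊆ Y → ∣ Y ∣ ≡ N + ∣ X ∣ → ∃ λ k → T u v X Y ≡ ℤ.+ k
    T-nonNegative N {X} {Y} X⊆Y size with ⊆⇒≡⊎∃ X Y X⊆Y
    ... | inj₁ refl = 1 , T-empty u v X
    T-nonNegative zero {X} {Y} X⊆Y size | inj₂ (e , e∈Y , e∉X) =
      contradiction size (>⇒≢ (p⊂q⇒∣p∣<∣q∣ (X⊆Y , e , e∈Y , e∉X)))
    T-nonNegative (suc N) {X} {Y} X⊆Y size | inj₂ (e , e∈Y , e∉X)
      with T-nonNegative N (add-⊆ e∈Y X⊆Y) (trans size (trans (sym (+-suc N _)) (cong (N +_) (sym (∣add∣ e∉X)))))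
         | T-nonNegative N (⊆-del e∉X X⊆Y) (suc-injective (trans (sym (∣del∣ e∈Y)) size))
         | add-dichotomy e X | del-dichotomy Y e∈Y
    ... | k , p | l , q | inj₁ loop | _ = y * k ,
      trans (T-loop u v X⊆Y e∈Y e∉X loop) (trans (cong₂ ℤ._*_ (-1+1 (ℤ.+ y)) p) (sym (ℤ.pos-* y k)))
    ... | k , p | l , q | inj₂ _ | inj₂ coloop = x * l ,
      trans (T-coloop u v X⊆Y e∈Y e∉X coloop) (trans (cong₂ ℤ._*_ (-1+1 (ℤ.+ x)) q) (sym (ℤ.pos-* x l)))
    ... | k , p | l , q | inj₂ nl | inj₁ nc = k + l , trans (T-delcon u v X⊆Y e∈Y e∉X nl nc) (cong₂ ℤ._+_ p q)

    abstract
      -- On genuine intervals the absolute value loses nothing; `+t` recovers the integer.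
      t : Subset n → Subset n → ℕ
      t X Y = ℤ.∣ T u v X Y ∣

      t≡∣T∣ : ∀ X Y → t X Y ≡ ℤ.∣ T u v X Y ∣
      t≡∣T∣ X Y = refl

    +t : ∀ {X Y} → X ⊆ Y → ℤ.+ t X Y ≡ T u v X Y
    +t {X} {Y} X⊆Y with T-nonNegative (∣ Y ∣ ∸ ∣ X ∣) X⊆Y (sym (m∸n+n≡m (p⊆q⇒∣p∣≤∣q∣ X⊆Y)))
    ... | k , p = trans (cong ℤ.+_ (trans (t≡∣T∣ X Y) (cong ℤ.∣_∣ p))) (sym p)

    t-empty : ∀ X → t X X ≡ 1
    t-empty X = trans (t≡∣T∣ X X) (cong ℤ.∣_∣ (T-empty u v X))

    module _ {e : Fin n} {X Y : Subset n} (X⊆Y : X ⊆ Y) (e∈Y : e ∈ Y) (e∉X : e ∉ X) where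
      private
        +t-add : ℤ.+ t (add e X) Y ≡ T u v (add e X) Y
        +t-add = +t (add-⊆ e∈Y X⊆Y)
        +t-del : ℤ.+ t X (del e Y) ≡ T u v X (del e Y)
        +t-del = +t (⊆-del e∉X X⊆Y)

      t-loop-eq : r (add e X) ≡ r X → t (add e X) Y ≡ t X (del e Y)
      t-loop-eq p = ℤ.+-injective (trans +t-add (trans (T-loop-eq u v X⊆Y e∈Y e∉X p) (sym +t-del)))

      t-coloop-eq : r Y ≡ suc (r (del e Y)) → t (add e X) Y ≡ t X (del e Y)
      t-coloop-eq p = ℤ.+-injective (trans +t-add (trans (T-coloop-eq u v X⊆Y e∈Y e∉X p) (sym +t-del)))

      t-loop : r (add e X) ≡ r X → t X Y ≡ y * t (add e X) Y
      t-loop p = ℤ.+-injective (trans (+t X⊆Y) (trans (T-loop u v X⊆Y e∈Y e∉X p)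
        (trans (cong₂ ℤ._*_ (-1+1 (ℤ.+ y)) (sym +t-add)) (sym (ℤ.pos-* y _)))))

      t-coloop : r Y ≡ suc (r (del e Y)) → t X Y ≡ x * t X (del e Y)
      t-coloop p = ℤ.+-injective (trans (+t X⊆Y) (trans (T-coloop u v X⊆Y e∈Y e∉X p)
        (trans (cong₂ ℤ._*_ (-1+1 (ℤ.+ x)) (sym +t-del)) (sym (ℤ.pos-* x _)))))

      t-delcon : r (add e X) ≡ suc (r X) → r (del e Y) ≡ r Y → t X Y ≡ t (add e X) Y + t X (del e Y)
      t-delcon p q = ℤ.+-injective (trans (+t X⊆Y) (trans (T-delcon u v X⊆Y e∈Y e∉X p q)
        (cong₂ ℤ._+_ (sym +t-add) (sym +t-del))))

-- Numerical estimates

square-cancel-≤ : ∀ m n → m * m ≤ n * n → m ≤ n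
square-cancel-≤ m n h = ≮⇒≥ λ n<m → <⇒≱ (*-mono-< n<m n<m) h

4mn≤[m+n]² : ∀ m n → 4 * (m * n) ≤ (m + n) * (m + n)
4mn≤[m+n]² m n with ≤-total m n
... | inj₁ m≤n with d , refl ← m≤n⇒∃[o]m+o≡n m≤n = subst (4 * (m * (m + d)) ≤_) (e m d) (m≤m+n _ (d * d))
  where
  e : ∀ m d → 4 * (m * (m + d)) + d * d ≡ (m + (m + d)) * (m + (m + d))
  e = solve-∀
... | inj₂ n≤m with d , refl ← m≤n⇒∃[o]m+o≡n n≤m = subst (4 * ((n + d) * n) ≤_) (e n d) (m≤m+n _ (d * d))
  where
  e : ∀ n d → 4 * ((n + d) * n) + d * d ≡ ((n + d) + n) * ((n + d) + n)
  e = solve-∀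

-- The cross term needs `2cc′ ≤ ab′ + a′b`. It is proved after squaring, which avoids square roots:
-- `4c²c′²` is at most `4(ab)(a′b′) = 4(ab′)(a′b)`, and the inequality of arithmetic and geometric
-- means applies.
cauchy-schwarz : ∀ {a b c a′ b′ c′} → c * c ≤ a * b → c′ * c′ ≤ a′ * b′ →
                 (c + c′) * (c + c′) ≤ (a + a′) * (b + b′)
cauchy-schwarz {a} {b} {c} {a′} {b′} {c′} h h′ = begin
  (c + c′) * (c + c′)                  ≡⟨ e₁ c c′ ⟩
  c * c + c′ * c′ + 2 * (c * c′)       ≤⟨ +-mono-≤ (+-mono-≤ h h′) (square-cancel-≤ (2 * (c * c′)) (a * b′ + a′ * b) cross) ⟩
  a * b + a′ * b′ + (a * b′ + a′ * b)  ≡⟨ e₂ a b a′ b′ ⟩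
  (a + a′) * (b + b′)                  ∎
  where
  open ≤-Reasoning
  e₁ : ∀ c c′ → (c + c′) * (c + c′) ≡ c * c + c′ * c′ + 2 * (c * c′)
  e₁ = solve-∀
  e₂ : ∀ a b a′ b′ → a * b + a′ * b′ + (a * b′ + a′ * b) ≡ (a + a′) * (b + b′)
  e₂ = solve-∀
  e₃ : ∀ c c′ → 2 * (c * c′) * (2 * (c * c′)) ≡ 4 * ((c * c) * (c′ * c′))
  e₃ = solve-∀
  e₄ : ∀ a b a′ b′ → 4 * ((a * b) * (a′ * b′)) ≡ 4 * ((a * b′) * (a′ * b))
  e₄ = solve-∀
  cross : 2 * (c * c′) * (2 * (c * c′)) ≤ (a * b′ + a′ * b) * (a * b′ + a′ * b)
  cross = begin
    2 * (c * c′) * (2 * (c * c′))              ≡⟨ e₃ c c′ ⟩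
    4 * ((c * c) * (c′ * c′))                  ≤⟨ *-monoʳ-≤ 4 (*-mono-≤ h h′) ⟩
    4 * ((a * b) * (a′ * b′))                  ≡⟨ e₄ a b a′ b′ ⟩
    4 * ((a * b′) * (a′ * b))                  ≤⟨ 4mn≤[m+n]² (a * b′) (a′ * b) ⟩
    (a * b′ + a′ * b) * (a * b′ + a′ * b)      ∎

m²+4≤2*2^m : ∀ k → let m = 2 + k in m * m + 4 ≤ 2 * 2 ^ m
m²+4≤2*2^m zero = ≤-refl
m²+4≤2*2^m (suc k) = ≤-trans (≤-trans (m≤m+n _ (k * k + 2 * k + 3)) (≤-reflexive (e k)))
  (*-monoʳ-≤ 2 (m²+4≤2*2^m k))
  where
  e : ∀ k → (3 + k) * (3 + k) + 4 + (k * k + 2 * k + 3) ≡ 2 * ((2 + k) * (2 + k) + 4)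
  e = solve-∀

3m²+4≤4*2^m : ∀ k → let m = 2 + k in 3 * (m * m) + 4 ≤ 4 * 2 ^ m
3m²+4≤4*2^m zero = ≤-refl
3m²+4≤4*2^m (suc k) = ≤-trans (≤-trans (m≤m+n _ (3 * (k * k) + 6 * k + 1)) (≤-reflexive (e k)))
  (≤-trans (*-monoʳ-≤ 2 (3m²+4≤4*2^m k)) (≤-reflexive (e′ (2 ^ (2 + k)))))
  where
  e : ∀ k → 3 * ((3 + k) * (3 + k)) + 4 + (3 * (k * k) + 6 * k + 1) ≡ 2 * (3 * ((2 + k) * (2 + k)) + 4)
  e = solve-∀
  e′ : ∀ z → 2 * (4 * z) ≡ 4 * (2 * z)
  e′ = solve-∀

-- The range starts at 3, with equality there; at 2 the claim would read 28 ≤ 24.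
4m²+12≤6*2^m : ∀ k → let m = 3 + k in 4 * (m * m) + 12 ≤ 6 * 2 ^ m
4m²+12≤6*2^m zero = ≤-refl
4m²+12≤6*2^m (suc k) = ≤-trans (≤-trans (m≤m+n _ (4 * (k * k) + 16 * k + 20)) (≤-reflexive (e k)))
  (≤-trans (*-monoʳ-≤ 2 (4m²+12≤6*2^m k)) (≤-reflexive (e′ (2 ^ (3 + k)))))
  where
  e : ∀ k → 4 * ((4 + k) * (4 + k)) + 12 + (4 * (k * k) + 16 * k + 20) ≡ 2 * (4 * ((3 + k) * (3 + k)) + 12)
  e = solve-∀
  e′ : ∀ z → 2 * (6 * z) ≡ 6 * (2 * z)
  e′ = solve-∀

-- The sum `1 + y + ... + y^(p-1)`. The Tutte polynomial of a parallel class of `p + 1` elements is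
-- `x + y * geometric y p`, and that of a circuit of `m + 1` elements is `y + x * geometric x m`.
geometric : ℕ → ℕ → ℕ
geometric y zero = 0
geometric y (suc p) = 1 + y * geometric y p

geometric-snoc : ∀ y p → geometric y (suc p) ≡ y ^ p + geometric y p
geometric-snoc y zero = cong suc (*-zeroʳ y)
geometric-snoc y (suc p) = trans (cong (λ g → 1 + y * g) (geometric-snoc y p)) (e y (y ^ p) (geometric y p))
  where
  e : ∀ y z g → 1 + y * (z + g) ≡ y * z + (1 + y * g)
  e = solve-∀

geometric-1 : ∀ p → geometric 1 p ≡ p
geometric-1 zero = refl
geometric-1 (suc p) = cong suc (trans (+-identityʳ _) (geometric-1 p))

geometric-2 : ∀ p → suc (geometric 2 p) ≡ 2 ^ p
geometric-2 zero = refl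
geometric-2 (suc p) = trans (e (geometric 2 p)) (cong (2 *_) (geometric-2 p))
  where
  e : ∀ g → suc (1 + 2 * g) ≡ 2 * suc g
  e = solve-∀

-- Duality of Tutte polynomials and of the excluded minor

∁⊤≡⊥ : ∁ ⊤ ≡ ⊥ {n}
∁⊤≡⊥ {n} = map-replicate not true n

∁⊥≡⊤ : ∁ ⊥ ≡ ⊤ {n}
∁⊥≡⊤ {n} = map-replicate not false n

-- Complementing the summation index exchanges corank and nullity.
T-dual : ∀ (R : Rank n) u v {X Y} → X ⊆ Y → Tutte.T (dual R) u v X Y ≡ Tutte.T R v u (∁ Y) (∁ X)
T-dual {n} R u v {X} {Y} X⊆Y = trans (∑-∁ (Tutte.term (dual R) u v X Y) X⊆Y) (∑-cong (p⊆q⇒∁p⊇∁q X⊆Y) same)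
  where
  open Rank R
  same : ∀ A → ∁ Y ⊆ A → A ⊆ ∁ X → Tutte.term (dual R) u v X Y (∁ A) ≡ Tutte.term R v u (∁ Y) (∁ X) A
  same A _ _ = trans (ℤ.*-comm (u ℤ.^ (∣ Y ∣ + r (∁ Y) ∸ (∣ ∁ A ∣ + r (∁ (∁ A)))))
                               (v ℤ.^ (∣ ∁ A ∣ + (∣ X ∣ + r (∁ X)) ∸ (∣ X ∣ + (∣ ∁ A ∣ + r (∁ (∁ A))))))) (cong₂ (λ p q → v ℤ.^ p ℤ.* u ℤ.^ q)
    (trans (cong₂ _∸_ (e₁ ∣ ∁ A ∣ ∣ X ∣ (r (∁ X))) (trans (cong (λ B → ∣ X ∣ + (∣ ∁ A ∣ + r B)) (∁-involutive A)) (e₂ ∣ ∁ A ∣ ∣ X ∣ (r A))))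
      ([m+n]∸[m+o]≡n∸o (∣ ∁ A ∣ + ∣ X ∣) _ _))
    (begin
      ∣ Y ∣ + r (∁ Y) ∸ (∣ ∁ A ∣ + r (∁ (∁ A)))                              ≡⟨ cong (λ B → ∣ Y ∣ + r (∁ Y) ∸ (∣ ∁ A ∣ + r B)) (∁-involutive A) ⟩
      ∣ Y ∣ + r (∁ Y) ∸ (∣ ∁ A ∣ + r A)                                      ≡⟨ [m+n]∸[m+o]≡n∸o ∣ ∁ Y ∣ _ _ ⟨
      ∣ ∁ Y ∣ + (∣ Y ∣ + r (∁ Y)) ∸ (∣ ∁ Y ∣ + (∣ ∁ A ∣ + r A))              ≡⟨ cong₂ _∸_ (trans (e₃ ∣ ∁ Y ∣ ∣ Y ∣ (r (∁ Y))) (trans (cong (_+ r (∁ Y)) (trans (∣∁∣ Y) (sym (∣∁∣ A)))) (e₄ ∣ A ∣ ∣ ∁ A ∣ (r (∁ Y))))) (e₅ ∣ ∁ Y ∣ ∣ ∁ A ∣ (r A)) ⟩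
      ∣ ∁ A ∣ + (∣ A ∣ + r (∁ Y)) ∸ (∣ ∁ A ∣ + (∣ ∁ Y ∣ + r A))              ≡⟨ [m+n]∸[m+o]≡n∸o ∣ ∁ A ∣ _ _ ⟩
      ∣ A ∣ + r (∁ Y) ∸ (∣ ∁ Y ∣ + r A) ∎))
    where
    open ≡-Reasoning
    e₁ : ∀ a x p → a + (x + p) ≡ a + x + p
    e₁ = solve-∀
    e₂ : ∀ a x q → x + (a + q) ≡ a + x + q
    e₂ = solve-∀
    e₃ : ∀ a x q → a + (x + q) ≡ x + a + q
    e₃ = solve-∀
    e₄ : ∀ a x q → a + x + q ≡ x + (a + q)
    e₄ = solve-∀
    e₅ : ∀ a x q → a + (x + q) ≡ x + (a + q)
    e₅ = solve-∀

t-dual : ∀ (R : Rank n) x y {X Y} → X ⊆ Y → Tutte.t (dual R) x y X Y ≡ Tutte.t R y x (∁ Y) (∁ X)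
t-dual R x y X⊆Y = ℤ.+-injective (trans (Tutte.+t (dual R) x y X⊆Y)
  (trans (T-dual R _ _ X⊆Y) (sym (Tutte.+t R y x (p⊆q⇒∁p⊇∁q X⊆Y)))))

-- No minor is isomorphic to U₀,₁ ⊕ U₁,₂ ⊕ U₁,₁: the excluded minor
-- of elementary split matroids; f and g are the elements of U₁,₂.
ElementarySplit : Rank n → Set
ElementarySplit {n} R = ∀ X (f g : Fin n) → f ∉ X → g ∉ X → f ≢ g → r X < ∣ X ∣ + r ⊥ →
  r (add f X) ≡ suc (r X) → r (add g X) ≡ suc (r X) → r (add g (add f X)) ≡ suc (r X) → r ⊤ ≤ suc (r X)
  where open Rank R

-- The excluded minor is self-dual, with `X′ = ∁ X - f - g` in the role of `X`. Dependence of `X` in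
-- the dual says that `X′ + f + g` is nonspanning in `R`; the assumed failure of spanning in the
-- dual says that `X′` is dependent in `R`; and `f`, `g` are parallel over `X` in the dual exactly
-- when they are parallel over `X′` in `R`.
dual-elementarySplit : ∀ (R : Rank n) → ElementarySplit R → ElementarySplit (dual R)
dual-elementarySplit {n} R split X f g f∉X g∉X f≢g dep rf rg rfg = ≮⇒≥ λ nonspanning → <⇒≱ r∁X<r⊤
  (subst (r ⊤ ≤_) (sym rX′) (split X′ f g f∉X′ g∉X′ f≢g (dependent nonspanning)
    (trans (cong r add-f) (trans rg′ rX′)) (trans (cong r add-g) (trans rf′ rX′))
    (trans (cong r (trans (cong (add g) add-f) (add-del g∈∁X))) rX′)))
  where
  open RankTheory R
  f∈∁X : f ∈ ∁ X
  f∈∁X = x∉p⇒x∈∁p f∉X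
  g∈∁X : g ∈ ∁ X
  g∈∁X = x∉p⇒x∈∁p g∉X
  X′ : Subset n
  X′ = del g (del f (∁ X))
  g∉X′ : g ∉ X′
  g∉X′ = x∉del g _
  f∉X′ : f ∉ X′
  f∉X′ = ∉-del g (x∉del f _)
  add-f : add f X′ ≡ del g (∁ X)
  add-f = trans (add-del-comm _ f≢g) (cong (del g) (add-del f∈∁X))
  add-g : add g X′ ≡ del f (∁ X)
  add-g = add-del (∈-del (f≢g ∘ sym) g∈∁X)
  cancel : ∀ {h p} → h ∉ X → ∣ add h X ∣ + p ≡ suc (∣ X ∣ + r (∁ X)) → p ≡ r (∁ X)
  cancel h∉X p rewrite ∣add∣ h∉X = +-cancelˡ-≡ ∣ X ∣ _ _ (suc-injective p)
  rf′ : r (del f (∁ X)) ≡ r (∁ X)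
  rf′ = trans (cong r (sym (∁-add f X))) (cancel f∉X rf)
  rg′ : r (del g (∁ X)) ≡ r (∁ X)
  rg′ = trans (cong r (sym (∁-add g X))) (cancel g∉X rg)
  rX′ : r (∁ X) ≡ suc (r X′)
  rX′ = sym (+-cancelˡ-≡ ∣ X ∣ _ _ (suc-injective (trans (trans (cong suc (+-suc ∣ X ∣ _))
    (cong₂ _+_ (sym (trans (∣add∣ (∉-add (f≢g ∘ sym) g∉X)) (cong suc (∣add∣ f∉X))))
      (cong r (sym (trans (∁-add g _) (cong (del g) (∁-add f X))))))) rfg)))
  r∁X<r⊤ : r (∁ X) < r ⊤
  r∁X<r⊤ = +-cancelˡ-< ∣ X ∣ _ _ (subst (∣ X ∣ + r (∁ X) <_) (cong (∣ X ∣ +_) (cong₂ _+_ (∣⊥∣≡0 n) (cong r ∁⊥≡⊤))) dep)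
  dependent : suc (∣ X ∣ + r (∁ X)) < ∣ ⊤ {n} ∣ + r (∁ ⊤) → r X′ < ∣ X′ ∣ + r ⊥
  dependent lt = s≤s⁻¹ (s≤s⁻¹ (+-cancelˡ-≤ ∣ X ∣ _ _ (subst₂ _≤_
    (trans (cong (λ k → suc (suc (∣ X ∣ + k))) rX′) (e₁ ∣ X ∣ (r X′)))
    (trans (cong₂ _+_ (trans (∣⊤∣≡n n) (sym (∣∁∣ X))) (cong r ∁⊤≡⊥)) (trans (cong (λ k → ∣ X ∣ + k + r ⊥) ∣∁X∣) (e₂ ∣ X ∣ ∣ X′ ∣ (r ⊥)))) lt)))
    where
    ∣∁X∣ : ∣ ∁ X ∣ ≡ suc (suc ∣ X′ ∣)
    ∣∁X∣ = trans (∣del∣ f∈∁X) (cong suc (∣del∣ (∈-del (f≢g ∘ sym) g∈∁X)))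
    e₁ : ∀ a b → suc (suc (a + suc b)) ≡ a + suc (suc (suc b))
    e₁ = solve-∀
    e₂ : ∀ a b c → a + suc (suc b) + c ≡ a + (suc (suc (b + c)))
    e₂ = solve-∀

-- Intervals of known size and the Tutte polynomials of special minors

record Gap {n : ℕ} (X : Subset n) (m : ℕ) (Y : Subset n) : Set where
  constructor gap
  field
    ⊆-of : X ⊆ Y
    card-of : ∣ Y ∣ ≡ m + ∣ X ∣
open Gap public

module _ {n : ℕ} {X Y : Subset n} where
  ⊆⇒Gap : X ⊆ Y → ∃ λ m → Gap X m Y
  ⊆⇒Gap X⊆Y = ∣ Y ∣ ∸ ∣ X ∣ , gap X⊆Y (sym (m∸n+n≡m (p⊆q⇒∣p∣≤∣q∣ X⊆Y)))

  gap-zero : Gap X 0 Y → X ≡ Y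
  gap-zero (gap X⊆Y size) with ⊆⇒≡⊎∃ X Y X⊆Y
  ... | inj₁ X≡Y = X≡Y
  ... | inj₂ (e , e∈Y , e∉X) = contradiction size (>⇒≢ (p⊂q⇒∣p∣<∣q∣ (X⊆Y , e , e∈Y , e∉X)))

  gap-suc : ∀ {m} → Gap X (suc m) Y → ∃ λ e → e ∈ Y × e ∉ X
  gap-suc (gap X⊆Y size) with ⊆⇒≡⊎∃ X Y X⊆Y
  ... | inj₁ refl = contradiction (sym size) (>⇒≢ (s≤s (m≤n+m _ _)))
  ... | inj₂ p = p

  gap-add : ∀ {e m} → e ∈ Y → e ∉ X → Gap X (suc m) Y → Gap (add e X) m Y
  gap-add {m = m} e∈Y e∉X (gap X⊆Y size) = gap (add-⊆ e∈Y X⊆Y)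
    (trans size (trans (sym (+-suc m _)) (cong (m +_) (sym (∣add∣ e∉X)))))

  gap-del : ∀ {e m} → e ∈ Y → e ∉ X → Gap X (suc m) Y → Gap X m (del e Y)
  gap-del e∈Y e∉X (gap X⊆Y size) = gap (⊆-del e∉X X⊆Y) (suc-injective (trans (sym (∣del∣ e∈Y)) size))

module Minors {n : ℕ} (R : Rank n) where
  open RankTheory R public
  open Tutte R public

  Loopless Coloopless : Subset n → Subset n → Set
  Loopless X Y = ∀ {e} → e ∈ Y → e ∉ X → r (add e X) ≡ suc (r X)
  Coloopless X Y = ∀ {e} → e ∈ Y → e ∉ X → r (del e Y) ≡ r Y

  t-loops : ∀ x y {p X Y Q} → Gap X p Q → Q ⊆ Y → r Q ≡ r X → t x y X Y ≡ y ^ p * t x y Q Y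
  t-loops x y {zero} X⊆Q Q⊆Y rQ rewrite gap-zero X⊆Q = sym (+-identityʳ _)
  t-loops x y {suc p} {X} {Y} {Q} X⊆Q Q⊆Y rQ with e , e∈Q , e∉X ← gap-suc X⊆Q =
    trans (t-loop x y (Q⊆Y ∘ ⊆-of X⊆Q) (Q⊆Y e∈Q) e∉X loop)
      (trans (cong (y *_) (t-loops x y (gap-add e∈Q e∉X X⊆Q) Q⊆Y (trans rQ (sym loop)))) (sym (*-assoc y _ _)))
    where
    loop : r (add e X) ≡ r X
    loop = ≤-antisym (subst (r (add e X) ≤_) rQ (r-mono (add-⊆ e∈Q (⊆-of X⊆Q)))) (r-≤-add e X)

  t-free : ∀ x y {m X Y} → Gap X m Y → r Y ≡ m + r X → t x y X Y ≡ x ^ m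
  t-free x y {zero} {X} X⊆Y _ with refl ← gap-zero X⊆Y = t-empty x y X
  t-free x y {suc m} {X} {Y} X⊆Y rk with e , e∈Y , e∉X ← gap-suc X⊆Y | del-dichotomy Y e∈Y
  ... | inj₂ coloop = trans (t-coloop x y (⊆-of X⊆Y) e∈Y e∉X coloop)
        (cong (x *_) (t-free x y (gap-del e∈Y e∉X X⊆Y) (suc-injective (trans (sym coloop) rk))))
  ... | inj₁ nc = contradiction (r-card (⊆-del e∉X (⊆-of X⊆Y))) (<⇒≱ (≤-reflexive
        (trans (cong suc (trans (cong (r X +_) (card-of (gap-del e∈Y e∉X X⊆Y))) (e₁ (r X) m ∣ X ∣))) (cong (_+ ∣ X ∣) (sym (trans nc rk))))))
    where
    e₁ : ∀ a m c → a + (m + c) ≡ m + a + c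
    e₁ = solve-∀

  -- Contracting an element of a circuit leaves a shorter circuit, and deleting it leaves a free
  -- matroid, which contributes the next power of `x`. The shortest circuit is a single loop.
  t-circuit : ∀ x y {m X Y} → Gap X (suc m) Y → r Y ≡ m + r X → Coloopless X Y →
              t x y X Y ≡ y + x * geometric x m
  t-circuit x y {zero} {X} {Y} X⊆Y rk _ =
    trans (t-loops x y X⊆Y (λ i → i) rk) (trans (cong (y * 1 *_) (t-empty x y Y)) (e y x))
    where
    e : ∀ y x → y * 1 * 1 ≡ y + x * 0
    e = solve-∀
  t-circuit x y {suc m} {X} {Y} X⊆Y rk cl
    with e , e∈Y , e∉X ← gap-suc X⊆Y
    with e′ , e′∈Y , e′∉Xe ← gap-suc (gap-add e∈Y e∉X X⊆Y) =
    begin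
      t x y X Y                                   ≡⟨ t-delcon x y (⊆-of X⊆Y) e∈Y e∉X nl (cl e∈Y e∉X) ⟩
      t x y (add e X) Y + t x y X (del e Y)       ≡⟨ cong₂ _+_
        (t-circuit x y (gap-add e∈Y e∉X X⊆Y) (trans rk (trans (sym (+-suc m _)) (cong (m +_) (sym nl))))
          (λ i∈Y i∉ → cl i∈Y (i∉ ∘ ∈-add e)))
        (t-free x y (gap-del e∈Y e∉X X⊆Y) (trans (cl e∈Y e∉X) rk)) ⟩
      y + x * geometric x m + x * x ^ m           ≡⟨ d y x (geometric x m) (x ^ m) ⟩
      y + x * (x ^ m + geometric x m)             ≡⟨ cong (λ g → y + x * g) (geometric-snoc x m) ⟨
      y + x * geometric x (suc m) ∎
    where
    open ≡-Reasoning
    d : ∀ y x g p → y + x * g + x * p ≡ y + x * (p + g)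
    d = solve-∀
    nl : r (add e X) ≡ suc (r X)
    -- If `e` were a loop, `del e′ Y` would have only `m` further elements over `X`, too few for its
    -- rank `suc m` over `X`.
    nl = nonloop λ loop → <⇒≱ (≤-reflexive (sym (count loop))) (r-card (⊆-del e′∉Xe (add-⊆ e∈Y (⊆-of X⊆Y))))
      where
      count : r (add e X) ≡ r X → r (del e′ Y) + ∣ add e X ∣ ≡ suc (r (add e X) + ∣ del e′ Y ∣)
      count loop rewrite loop | cl e′∈Y (e′∉Xe ∘ ∈-add e) | rk | ∣add∣ e∉X | card-of (gap-del e′∈Y (e′∉Xe ∘ ∈-add e) X⊆Y) = c m (r X) ∣ X ∣
        where
        c : ∀ m a b → suc m + a + suc b ≡ suc (a + (suc m + b))
        c = solve-∀

  -- The first case is that of a direct summand Q ∖ X.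
  ParallelExpansion : ℕ → Subset n → Subset n → Subset n → Subset n → Set
  ParallelExpansion p X Z Q Y =
    (r Z < r Y × (∀ x y → t x y X Y ≡ (x + y * geometric y p) * t x y Q Y)) ⊎
    (r Z ≡ r Y × (∀ x y → t x y X Y ≡ t x y X Z + geometric y (suc p) * t x y Q Y))

  -- Z = Y ∖ (Q ∖ X); in parallel-class, Q ∖ X is a parallel class of the minor (X , Y).
  record IsDifference (X Z Q Y : Subset n) : Set where
    field
      X⊆Z : X ⊆ Z
      Z⊆Y : Z ⊆ Y
      Y⊆Z∪Q : ∀ {g} → g ∈ Y → g ∉ Z → g ∈ Q
      Z∩Q⊆X : ∀ {g} → g ∈ Z → g ∈ Q → g ∈ X

  -- The elements of the class are deleted one by one. Contracting one of them turns those still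
  -- present into loops, which gives the successive powers of `y`. Whether the last one is a coloop
  -- by then decides between the two expansions.
  parallel-class : ∀ {p X Y Q} → Gap X (suc p) Q → Q ⊆ Y → r Q ≡ suc (r X) → Loopless X Q →
    ∃ λ Z → IsDifference X Z Q Y × ∣ Y ∣ ≡ suc p + ∣ Z ∣ × ParallelExpansion p X Z Q Y
  parallel-class {zero} {X} {Y} {Q} (gap X⊆Q size) Q⊆Y rQ ll
    with e , e∈Q , e∉X ← gap-suc (gap X⊆Q size)
    with refl ← gap-zero (gap-add e∈Q e∉X (gap X⊆Q size)) =
    del e Y , difference , ∣del∣ e∈Y , expansion (del-dichotomy Y e∈Y)
    where
    e∈Y : e ∈ Y
    e∈Y = Q⊆Y e∈Q
    difference : IsDifference X (del e Y) (add e X) Y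
    difference = record
      { X⊆Z = ⊆-del e∉X (Q⊆Y ∘ X⊆Q)
      ; Z⊆Y = del-⊆ e Y
      ; Y⊆Z∪Q = λ {g} g∈Y g∉Z → rest g g∈Y g∉Z
      ; Z∩Q⊆X = λ g∈Z g∈Q → [ (λ g≡e → contradiction g≡e (∈del⇒≢ Y g∈Z)) , (λ i → i) ]′ (add⁻ e X g∈Q)
      }
      where
      rest : ∀ g → g ∈ Y → g ∉ del e Y → g ∈ add e X
      rest g g∈Y g∉Z with g Fin.≟ e
      ... | yes refl = e∈Q
      ... | no g≢e = contradiction (∈-del g≢e g∈Y) g∉Z
    expansion : r (del e Y) ≡ r Y ⊎ r Y ≡ suc (r (del e Y)) → ParallelExpansion 0 X (del e Y) (add e X) Y
    expansion (inj₂ coloop) = inj₁ (≤-reflexive (sym coloop) , λ x y →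
      trans (t-coloop x y (Q⊆Y ∘ X⊆Q) e∈Y e∉X coloop)
        (cong₂ _*_ (d x y) (sym (t-coloop-eq x y (Q⊆Y ∘ X⊆Q) e∈Y e∉X coloop))))
      where
      d : ∀ x y → x ≡ x + y * 0
      d = solve-∀
    expansion (inj₁ nc) = inj₂ (nc , λ x y →
      trans (t-delcon x y (Q⊆Y ∘ X⊆Q) e∈Y e∉X rQ nc) (d y (t x y (add e X) Y) (t x y X (del e Y))))
      where
      d : ∀ y a b → a + b ≡ b + (1 + y * 0) * a
      d = solve-∀
  parallel-class {suc p} {X} {Y} {Q} (gap X⊆Q size) Q⊆Y rQ ll
    with e , e∈Q , e∉X ← gap-suc (gap X⊆Q size)
    with e′ , e′∈Q′ , e′∉X ← gap-suc (gap-del e∈Q e∉X (gap X⊆Q size)) = step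
    where
    Q′ Y′ : Subset n
    Q′ = del e Q
    Y′ = del e Y
    X⊆Y : X ⊆ Y
    X⊆Y = Q⊆Y ∘ X⊆Q
    e∈Y : e ∈ Y
    e∈Y = Q⊆Y e∈Q
    X⊆Q′ : X ⊆ Q′
    X⊆Q′ = ⊆-del e∉X X⊆Q
    Q′⊆Y : Q′ ⊆ Y
    Q′⊆Y = Q⊆Y ∘ del⁻ e Q
    Q′⊆Y′ : Q′ ⊆ Y′
    Q′⊆Y′ = ⊆-del (x∉del e Q) Q′⊆Y
    rQ′ : r Q′ ≡ suc (r X)
    rQ′ = ≤-antisym (≤-trans (r-del-≤ e Q) (≤-reflexive rQ))
      (subst (_≤ r Q′) (ll (del⁻ e Q e′∈Q′) e′∉X) (r-mono (add-⊆ e′∈Q′ X⊆Q′)))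
    e-loop : r (add e Q′) ≡ r Q′
    e-loop = trans (cong r (add-del e∈Q)) (trans rQ (sym rQ′))
    nc : r Y′ ≡ r Y
    nc = noncoloop e∈Y Q′⊆Y′ e-loop
    same : ∀ x y → t x y Q′ Y′ ≡ t x y Q Y
    -- Over `Q′` the element `e` is a loop, so deleting and contracting it agree.
    same x y = trans (sym (t-loop-eq x y Q′⊆Y e∈Y (x∉del e Q) e-loop)) (cong (λ A → t x y A Y) (add-del e∈Q))
    contracted : ∀ x y → t x y (add e X) Y ≡ y ^ suc p * t x y Q Y
    contracted x y = t-loops x y (gap-add e∈Q e∉X (gap X⊆Q size)) Q⊆Y (trans rQ (sym (ll e∈Q e∉X)))
    delcon : ∀ x y → t x y X Y ≡ y ^ suc p * t x y Q Y + t x y X Y′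
    delcon x y = trans (t-delcon x y X⊆Y e∈Y e∉X (ll e∈Q e∉X) nc) (cong (_+ t x y X Y′) (contracted x y))
    step : ∃ λ Z → IsDifference X Z Q Y × ∣ Y ∣ ≡ suc (suc p) + ∣ Z ∣ × ParallelExpansion (suc p) X Z Q Y
    step with parallel-class (gap-del e∈Q e∉X (gap X⊆Q size)) Q′⊆Y′ rQ′ (λ i → ll (del⁻ e Q i))
    ... | Z , diff , sizeZ , expansion = Z , difference , trans (∣del∣ e∈Y) (cong suc sizeZ) , extend expansion
      where
      open IsDifference diff
      difference : IsDifference X Z Q Y
      difference = record
        { X⊆Z = X⊆Z
        ; Z⊆Y = del⁻ e Y ∘ Z⊆Y
        ; Y⊆Z∪Q = λ {g} → rest g
        ; Z∩Q⊆X = λ g∈Z g∈Q → Z∩Q⊆X g∈Z (∈-del (∈del⇒≢ Y (Z⊆Y g∈Z)) g∈Q)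
        }
        where
        rest : ∀ g → g ∈ Y → g ∉ Z → g ∈ Q
        rest g g∈Y g∉Z with g Fin.≟ e
        ... | yes refl = e∈Q
        ... | no g≢e = del⁻ e Q (Y⊆Z∪Q (∈-del g≢e g∈Y) g∉Z)
      extend : ParallelExpansion p X Z Q′ Y′ → ParallelExpansion (suc p) X Z Q Y
      extend (inj₁ (rZ , h)) = inj₁ (subst (r Z <_) nc rZ , λ x y → begin
        t x y X Y                                                                     ≡⟨ delcon x y ⟩
        y ^ suc p * t x y Q Y + t x y X Y′                                            ≡⟨ cong (y ^ suc p * t x y Q Y +_) (trans (h x y) (cong ((x + y * geometric y p) *_) (same x y))) ⟩
        y ^ suc p * t x y Q Y + (x + y * geometric y p) * t x y Q Y                   ≡⟨ d x y (y ^ p) (geometric y p) (t x y Q Y) ⟩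
        (x + y * (y ^ p + geometric y p)) * t x y Q Y                                 ≡⟨ cong (λ g → (x + y * g) * t x y Q Y) (geometric-snoc y p) ⟨
        (x + y * geometric y (suc p)) * t x y Q Y                                     ∎)
        where
        open ≡-Reasoning
        d : ∀ x y q g a → y * q * a + (x + y * g) * a ≡ (x + y * (q + g)) * a
        d = solve-∀
      extend (inj₂ (rZ , h)) = inj₂ (trans rZ nc , λ x y → begin
        t x y X Y                                                                     ≡⟨ delcon x y ⟩
        y ^ suc p * t x y Q Y + t x y X Y′                                            ≡⟨ cong (y ^ suc p * t x y Q Y +_) (trans (h x y) (cong (λ b → t x y X Z + geometric y (suc p) * b) (same x y))) ⟩
        y ^ suc p * t x y Q Y + (t x y X Z + geometric y (suc p) * t x y Q Y)         ≡⟨ d (y ^ suc p) (geometric y (suc p)) (t x y Q Y) (t x y X Z) ⟩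
        t x y X Z + (y ^ suc p + geometric y (suc p)) * t x y Q Y                     ≡⟨ cong (λ g → t x y X Z + g * t x y Q Y) (geometric-snoc y (suc p)) ⟨
        t x y X Z + geometric y (suc (suc p)) * t x y Q Y                             ∎)
        where
        open ≡-Reasoning
        d : ∀ q g a b → q * a + (b + g * a) ≡ b + (q + g) * a
        d = solve-∀

  -- Contracting a dependent set leaves only uniform matroids once loops are removed.
  nonspanning⇒free : ElementarySplit R → ∀ {N Q W} → Gap Q N W → Loopless Q W →
                     r Q < ∣ Q ∣ + r ⊥ → r W < r ⊤ → r W ≡ N + r Q
  nonspanning⇒free split {zero} Q⊆W ll dep nonspan = cong r (sym (gap-zero Q⊆W))
  nonspanning⇒free split {suc zero} {Q} Q⊆W ll dep nonspan
    with w , w∈W , w∉Q ← gap-suc Q⊆W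
    with refl ← gap-zero (gap-add w∈W w∉Q Q⊆W) = ll w∈W w∉Q
  nonspanning⇒free split {suc (suc N)} {Q} {W} Q⊆W ll dep nonspan
    with w , w∈W , w∉Q ← gap-suc Q⊆W
    with w′ , w′∈W′ , w′∉Q ← gap-suc (gap-del w∈W w∉Q Q⊆W) =
    conclude (del-dichotomy W w∈W)
    where
    w′∈W : w′ ∈ W
    w′∈W = del⁻ w W w′∈W′
    w≢w′ : w ≢ w′
    w≢w′ w≡w′ = ∈del⇒≢ W w′∈W′ (sym w≡w′)
    Q⊆W′ : Gap Q (suc N) (del w W)
    Q⊆W′ = gap-del w∈W w∉Q Q⊆W
    V : Subset n
    V = del w′ (del w W)
    rW′ : r (del w W) ≡ suc N + r Q
    rW′ = nonspanning⇒free split Q⊆W′ (λ i → ll (del⁻ w W i)) dep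
      (≤-<-trans (r-del-≤ w W) nonspan)
    rV+w : r (del w′ W) ≡ suc N + r Q
    rV+w = nonspanning⇒free split (gap-del w′∈W w′∉Q Q⊆W) (λ i → ll (del⁻ w′ W i)) dep
      (≤-<-trans (r-del-≤ w′ W) nonspan)
    Q⊆V : Gap Q N V
    Q⊆V = gap-del w′∈W′ w′∉Q Q⊆W′
    rV : r V ≡ N + r Q
    rV = nonspanning⇒free split Q⊆V (λ i → ll (del⁻ w W (del⁻ w′ (del w W) i))) dep
      (≤-<-trans (≤-trans (r-del-≤ w′ _) (r-del-≤ w W)) nonspan)
    V+w : add w V ≡ del w′ W
    V+w = trans (add-del-comm _ w≢w′) (cong (del w′) (add-del w∈W))
    conclude : r (del w W) ≡ r W ⊎ r W ≡ suc (r (del w W)) → r W ≡ suc (suc N) + r Q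
    conclude (inj₂ coloop) = trans coloop (cong suc rW′)
    -- Otherwise `w` and `w′` are parallel over the dependent set `V`, and the excluded minor makes
    -- `W` spanning.
    conclude (inj₁ nc) = contradiction
      (split V w w′ (∉-del w′ (x∉del w W)) (x∉del w′ _) w≢w′
        (subst₂ _<_ (sym rV) (trans (sym (+-assoc N ∣ Q ∣ (r ⊥))) (cong (_+ r ⊥) (sym (card-of Q⊆V)))) (+-monoʳ-< N dep))
        (trans (cong r V+w) (trans rV+w (cong suc (sym rV))))
        (trans (cong r (add-del w′∈W′)) (trans rW′ (cong suc (sym rV))))
        (trans (cong r (trans (cong (add w′) V+w) (add-del w′∈W))) (trans (sym nc) (trans rW′ (cong suc (sym rV))))))
      (<⇒≱ (subst (_< r ⊤) (trans (sym nc) (trans rW′ (cong suc (sym rV)))) nonspan))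

module _ {n : ℕ} {P : Fin n → Set} (P? : Decidable P) where
  comprehension : Subset n
  comprehension = tabulate (λ x → does (P? x))

  ∈-comprehension⁺ : ∀ {x} → P x → x ∈ comprehension
  ∈-comprehension⁺ {x} p = lookup⇒[]= x comprehension (trans (lookup∘tabulate _ x) (dec-true (P? x) p))

  ∈-comprehension⁻ : ∀ {x} → x ∈ comprehension → P x
  ∈-comprehension⁻ {x} h with P? x | trans (sym (lookup∘tabulate (λ x → does (P? x)) x)) ([]=⇒lookup h)
  ... | yes p | _ = p

-- With `m = 2 + k` this is the inequality for `m` parallel elements, where `T(1,1) = m`,
-- `T(2,0) = 2` and `T(0,2) = 2^m - 2`.
geometric-bound₁ : ∀ k → let m = 2 + k in m * m ≤ 2 * (2 * geometric 2 (1 + k))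
geometric-bound₁ k = +-cancelʳ-≤ 4 _ _ (subst ((2 + k) * (2 + k) + 4 ≤_)
  (trans (cong (2 *_) (sym (geometric-2 (2 + k)))) (e (geometric 2 (1 + k)))) (m²+4≤2*2^m k))
  where
  e : ∀ g → 2 * suc (1 + 2 * g) ≡ 2 * (2 * g) + 4
  e = solve-∀

geometric-bound₂ : ∀ k → let m = 2 + k in 3 * (m * m) ≤ 4 * geometric 2 m
geometric-bound₂ k = +-cancelʳ-≤ 4 _ _ (subst (3 * ((2 + k) * (2 + k)) + 4 ≤_)
  (trans (cong (4 *_) (sym (geometric-2 (2 + k)))) (e (geometric 2 (2 + k)))) (3m²+4≤4*2^m k))
  where
  e : ∀ g → 4 * suc g ≡ 4 * g + 4
  e = solve-∀

geometric-bound₃ : ∀ k → let m = 3 + k in 4 * (m * m) ≤ 6 * (2 * geometric 2 (2 + k))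
geometric-bound₃ k = +-cancelʳ-≤ 12 _ _ (subst (4 * ((3 + k) * (3 + k)) + 12 ≤_)
  (trans (cong (6 *_) (sym (geometric-2 (3 + k)))) (e (geometric 2 (2 + k)))) (4m²+12≤6*2^m k))
  where
  e : ∀ g → 6 * suc (1 + 2 * g) ≡ 6 * (2 * g) + 12
  e = solve-∀

direct-sum-bound : ∀ k {a b c} → c * c ≤ a * b →
  (2 + k) * c * ((2 + k) * c) ≤ 2 * a * (2 * geometric 2 (1 + k) * b)
direct-sum-bound k {a} {b} {c} h = begin
  (2 + k) * c * ((2 + k) * c)                        ≡⟨ e₁ (2 + k) c ⟩
  ((2 + k) * (2 + k)) * (c * c)                      ≤⟨ *-mono-≤ (geometric-bound₁ k) h ⟩
  (2 * (2 * geometric 2 (1 + k))) * (a * b)          ≡⟨ e₂ (geometric 2 (1 + k)) a b ⟩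
  2 * a * (2 * geometric 2 (1 + k) * b)              ∎
  where
  open ≤-Reasoning
  e₁ : ∀ p c → p * c * (p * c) ≡ (p * p) * (c * c)
  e₁ = solve-∀
  e₂ : ∀ g a b → (2 * (2 * g)) * (a * b) ≡ 2 * a * (2 * g * b)
  e₂ = solve-∀

-- With `p = 2 + k` and `m = 2 + l` the factors on the right are `2 + 2(2^m - 2)` and
-- `2 + 2(2^p - 2)`. Cauchy-Schwarz splits off `1 * 1 ≤ 2 * 2`, and the rest is a product of two
-- instances of `geometric-bound₁`.
thick-circuit-bound : ∀ k l →
  (1 + (2 + k) * (2 + l)) * (1 + (2 + k) * (2 + l))
  ≤ (2 ^ (2 + l) + 1 * (2 * geometric 2 (1 + l))) * (0 + geometric 2 (2 + k) * 2)
thick-circuit-bound k l = begin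
  (1 + (2 + k) * (2 + l)) * (1 + (2 + k) * (2 + l))             ≤⟨ cauchy-schwarz {2} {2} {1} {2 * (2 * g)} {2 * (2 * h)} {(2 + k) * (2 + l)} (s≤s z≤n) (≤-trans (≤-reflexive (e₀ (2 + k) (2 + l))) (*-mono-≤ (geometric-bound₁ l) (geometric-bound₁ k))) ⟩
  (2 + 2 * (2 * g)) * (2 + 2 * (2 * h))                         ≡⟨ e₁ g h ⟩
  (suc (1 + 2 * g) + 1 * (2 * g)) * ((1 + 2 * h) * 2)           ≡⟨ cong (λ z → (z + 1 * (2 * g)) * ((1 + 2 * h) * 2)) (geometric-2 (2 + l)) ⟩
  (2 ^ (2 + l) + 1 * (2 * g)) * (0 + geometric 2 (2 + k) * 2)   ∎
  where
  open ≤-Reasoning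
  g h : ℕ
  g = geometric 2 (1 + l)
  h = geometric 2 (1 + k)
  e₀ : ∀ p m → p * m * (p * m) ≡ (m * m) * (p * p)
  e₀ = solve-∀
  e₁ : ∀ g h → (2 + 2 * (2 * g)) * (2 + 2 * (2 * h)) ≡ (suc (1 + 2 * g) + 1 * (2 * g)) * ((1 + 2 * h) * 2)
  e₁ = solve-∀

-- The new summands need `p²m² ≤ 2(2^p - 1)(2^m - 2)` for `p = 2 + k`, `m = 3 + l`. This is an
-- equality at `p = 2`, `m = 3` and false at `p = m = 2`. The factor 12 combines the constants of
-- the two bounds.
rank-2-bound : ∀ k l {a b c} → c * c ≤ a * b →
  (c + (2 + k) * (3 + l)) * (c + (2 + k) * (3 + l)) ≤ (a + 1 * 2) * (b + geometric 2 (2 + k) * (2 * geometric 2 (2 + l)))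
rank-2-bound k l {a} {b} {c} hyp =
  cauchy-schwarz {a} {b} {c} hyp (*-cancelˡ-≤ 12 (begin
    12 * ((2 + k) * (3 + l) * ((2 + k) * (3 + l)))       ≡⟨ e₁ (2 + k) (3 + l) ⟩
    (3 * ((2 + k) * (2 + k))) * (4 * ((3 + l) * (3 + l))) ≤⟨ *-mono-≤ (geometric-bound₂ k) (geometric-bound₃ l) ⟩
    (4 * g) * (6 * (2 * h))                               ≡⟨ e₂ g h ⟩
    12 * (1 * 2 * (g * (2 * h)))                          ∎))
  where
  open ≤-Reasoning
  g h : ℕ
  g = geometric 2 (2 + k)
  h = geometric 2 (2 + l)
  e₁ : ∀ p m → 12 * (p * m * (p * m)) ≡ (3 * (p * p)) * (4 * (m * m))
  e₁ = solve-∀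
  e₂ : ∀ g h → (4 * g) * (6 * (2 * h)) ≡ 12 * (1 * 2 * (g * (2 * h)))
  e₂ = solve-∀

-- The inequality for elementary split matroids

mw-subst : ∀ {a b c a′ b′ c′} → c ≡ c′ → a ≡ a′ → b ≡ b′ → c′ * c′ ≤ a′ * b′ → c * c ≤ a * b
mw-subst refl refl refl h = h

gap-sum : ∀ {n p q m} {X Q Y : Subset n} → Gap X p Q → Gap Q q Y → Gap X m Y → m ≡ q + p
gap-sum {p = p} {q} {m} {X} (gap _ s₁) (gap _ s₂) (gap _ s₃) = +-cancelʳ-≡ ∣ X ∣ _ _
  (trans (sym s₃) (trans s₂ (trans (cong (q +_) s₁) (sym (+-assoc q p ∣ X ∣)))))

module Partners {n : ℕ} (R : Rank n) where
  open Minors R public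

  MW : Subset n → Subset n → Set
  MW X Y = t 1 1 X Y * t 1 1 X Y ≤ t 2 0 X Y * t 0 2 X Y

  module _ (X Y : Subset n) (e : Fin n) where
    HasParallel HasSeries : Set
    HasParallel = ∃ λ f → f ∈ Y × f ∉ X × f ≢ e × r (add f (add e X)) ≡ r (add e X)
    HasSeries = ∃ λ f → f ∈ Y × f ∉ X × f ≢ e × r (del e Y) ≡ suc (r (del f (del e Y)))

    hasParallel? : Dec HasParallel
    hasParallel? = Fin.any? λ f → (f ∈? Y) ×-dec ¬? (f ∈? X) ×-dec ¬? (f Fin.≟ e) ×-dec (r (add f (add e X)) ≟ r (add e X))

    hasSeries? : Dec HasSeries
    hasSeries? = Fin.any? λ f → (f ∈? Y) ×-dec ¬? (f ∈? X) ×-dec ¬? (f Fin.≟ e) ×-dec (r (del e Y) ≟ suc (r (del f (del e Y))))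

module AllPaired {n : ℕ} (R : Rank n) (split : ElementarySplit R) {N : ℕ} {X Y : Subset n}
  (X⊆Y : Gap X N Y) (ll : Minors.Loopless R X Y) (cl : Minors.Coloopless R X Y)
  (IH : ∀ {M X′ Y′} → M < N → Gap X′ M Y′ → Minors.Loopless R X′ Y′ → Minors.Coloopless R X′ Y′ → Partners.MW R X′ Y′)
  (paired : ∀ {g} → g ∈ Y → g ∉ X → Partners.HasParallel R X Y g ⊎ Partners.HasSeries R X Y g)
  {e f : Fin n} (e∈Y : e ∈ Y) (e∉X : e ∉ X) (f∈Y : f ∈ Y) (f∉X : f ∉ X) (f≢e : f ≢ e)
  (e∥f : Rank.r R (add f (add e X)) ≡ Rank.r R (add e X)) where

  open Partners R

  -- Membership in the closure of `add e X` inside `Y`: the set `Q` consists of `X` and the parallel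
  -- class of `e` in the minor.
  Q? : ∀ g → Dec (g ∈ Y × r (add g (add e X)) ≡ r (add e X))
  Q? g = (g ∈? Y) ×-dec (r (add g (add e X)) ≟ r (add e X))

  abstract
    Q : Subset n
    Q = comprehension Q?

    ∈Q⁺ : ∀ {g} → g ∈ Y → r (add g (add e X)) ≡ r (add e X) → g ∈ Q
    ∈Q⁺ g∈Y p = ∈-comprehension⁺ Q? (g∈Y , p)

    ∈Q⁻ : ∀ {g} → g ∈ Q → g ∈ Y × r (add g (add e X)) ≡ r (add e X)
    ∈Q⁻ = ∈-comprehension⁻ Q?

  Q⊆Y : Q ⊆ Y
  Q⊆Y = proj₁ ∘ ∈Q⁻

  X+e⊆Q : add e X ⊆ Q
  X+e⊆Q g∈ = ∈Q⁺ (add-⊆ e∈Y (⊆-of X⊆Y) g∈) (cong r (add-∈ g∈))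

  X⊆Q : X ⊆ Q
  X⊆Q = X+e⊆Q ∘ ∈-add e

  e∈Q : e ∈ Q
  e∈Q = X+e⊆Q (x∈add e X)

  f∈Q : f ∈ Q
  f∈Q = ∈Q⁺ f∈Y e∥f

  rQ : r Q ≡ suc (r X)
  rQ = trans (closure-rank X+e⊆Q (λ g g∈Q → proj₂ (∈Q⁻ g∈Q))) (ll e∈Y e∉X)

  ∉Q⇒∉X : ∀ {g} → g ∉ Q → g ∉ X
  ∉Q⇒∉X g∉Q = g∉Q ∘ X⊆Q

  llXQ : Loopless X Q
  llXQ g∈Q = ll (Q⊆Y g∈Q)

  llQY : Loopless Q Y
  llQY {g} g∈Y g∉Q = nonloop λ loop → g∉Q (∈Q⁺ g∈Y (≤-antisym
    (≤-trans (r-mono (add-⊆ (x∈add g Q) (∈-add g ∘ X+e⊆Q))) (≤-reflexive (trans loop (trans rQ (sym (ll e∈Y e∉X))))))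
    (r-≤-add g (add e X))))

  clQY : Coloopless Q Y
  clQY g∈Y g∉Q = cl g∈Y (∉Q⇒∉X g∉Q)

  parallel-in-Q : ∀ {g h} → g ∈ Q → g ∉ X → h ∈ Q → r (add h (add g X)) ≡ r (add g X)
  parallel-in-Q {g} {h} g∈Q g∉X h∈Q = ≤-antisym
    (≤-trans (r-mono (add-⊆ h∈Q (add-⊆ g∈Q X⊆Q))) (≤-reflexive (trans rQ (sym (llXQ g∈Q g∉X)))))
    (r-≤-add h (add g X))

  parallel-sym : ∀ {g h} → g ∈ Y → g ∉ X → h ∈ Y → h ∉ X → r (add h (add g X)) ≡ r (add g X) → r (add g (add h X)) ≡ r (add h X)
  parallel-sym {g} {h} g∈Y g∉X h∈Y h∉X p = trans (cong r (add-comm g h X)) (trans p (trans (ll g∈Y g∉X) (sym (ll h∈Y h∉X))))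

  parallel∉Q : ∀ {g h} → g ∈ Y → g ∉ Q → h ∈ Y → h ∉ X → r (add h (add g X)) ≡ r (add g X) → h ∉ Q
  parallel∉Q g∈Y g∉Q h∈Y h∉X p h∈Q = 1+n≢n (trans (sym (llQY g∈Y g∉Q))
    (loop-⊆ (add-⊆ h∈Q X⊆Q) (parallel-sym g∈Y (∉Q⇒∉X g∉Q) h∈Y h∉X p)))

  -- An element of the class keeps a parallel partner in the class (`f` for `e`, and `e` for all
  -- others) when `g` is deleted, so it cannot become a coloop.
  series∉Q : ∀ {g h} → g ∈ Y → g ∉ Q → h ∈ Y → h ∉ X → h ≢ g → r (del g Y) ≡ suc (r (del h (del g Y))) → h ∉ Q
  series∉Q {g} {h} g∈Y g∉Q h∈Y h∉X h≢g ser h∈Q with h Fin.≟ e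
  ... | yes refl = 1+n≢n (trans (sym ser) (sym (noncoloop (∈-del h≢g h∈Y)
          (add-⊆ (∈-del f≢e (∈-del (λ { refl → g∉Q f∈Q }) f∈Y)) (⊆-del h∉X (⊆-del (∉Q⇒∉X g∉Q) (⊆-of X⊆Y))))
          (parallel-in-Q f∈Q f∉X h∈Q))))
  ... | no h≢e = 1+n≢n (trans (sym ser) (sym (noncoloop (∈-del h≢g h∈Y)
          (add-⊆ (∈-del (h≢e ∘ sym) (∈-del (λ { refl → g∉Q e∈Q }) e∈Y)) (⊆-del h∉X (⊆-del (∉Q⇒∉X g∉Q) (⊆-of X⊆Y))))
          (parallel-in-Q e∈Q e∉X h∈Q))))

  abstract
    Q-size : ∃ λ k → Gap X (2 + k) Q
    Q-size with ⊆⇒Gap X⊆Q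
    ... | zero , G = contradiction (subst (e ∈_) (sym (gap-zero G)) e∈Q) e∉X
    ... | suc zero , G = contradiction (subst (f ∈_) (sym (gap-zero (gap-add e∈Q e∉X G))) f∈Q) (∉-add f≢e f∉X)
    ... | suc (suc k) , G = k , G

  k : ℕ
  k = proj₁ Q-size

  X⊆Q-gap : Gap X (2 + k) Q
  X⊆Q-gap = proj₂ Q-size

  -- At least two elements over `X` raise the rank by only one. This makes `Q` usable as the
  -- dependent set of the excluded minor.
  dependent-Q : r Q < ∣ Q ∣ + r ⊥
  dependent-Q = begin-strict
    r Q                    ≡⟨ rQ ⟩
    suc (r X)              ≡⟨ cong suc (+-identityʳ (r X)) ⟨
    suc (r X + 0)          ≡⟨ cong (λ z → suc (r X + z)) (∣⊥∣≡0 n) ⟨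
    suc (r X + ∣ ⊥ {n} ∣)  ≤⟨ s≤s (r-card (⊆-min X)) ⟩
    suc (r ⊥ + ∣ X ∣)      ≡⟨ cong suc (+-comm (r ⊥) ∣ X ∣) ⟩
    suc (∣ X ∣ + r ⊥)      <⟨ s≤s (s≤s (m≤n+m _ k)) ⟩
    2 + (k + (∣ X ∣ + r ⊥)) ≡⟨ cong (2 +_) (+-assoc k ∣ X ∣ (r ⊥)) ⟨
    2 + k + ∣ X ∣ + r ⊥    ≡⟨ cong (_+ r ⊥) (card-of X⊆Q-gap) ⟨
    ∣ Q ∣ + r ⊥            ∎
    where open ≤-Reasoning

  module _ {Z : Subset n} (diff : IsDifference X Z Q Y) (sizeZ : ∣ Y ∣ ≡ 2 + k + ∣ Z ∣) (rZ : r Z ≡ r Y)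
    (expansion : ∀ x y → t x y X Y ≡ t x y X Z + geometric y (2 + k) * t x y Q Y) where
    open IsDifference diff

    gap-Z : ∀ {m} → Gap Q m Y → Gap X m Z
    gap-Z {m} Q⊆Y-gap = gap X⊆Z (+-cancelˡ-≡ (2 + k) _ _
      (trans (sym sizeZ) (trans (card-of Q⊆Y-gap) (trans (cong (m +_) (card-of X⊆Q-gap)) (d m (2 + k) ∣ X ∣)))))
      where
      d : ∀ m k x → m + (k + x) ≡ k + (m + x)
      d = solve-∀

    -- The series partner `h` makes `Y - g - h` nonspanning, hence free over `Q`. Putting `g` and
    -- `h` back raises the rank by one without creating coloops, so `Y` over `Q` is a circuit.
    -- Counting then shows that `Z` over `X` is free.
    circuit-case : ∀ {g} → g ∈ Y → g ∉ Q → HasSeries X Y g → MW X Y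
    circuit-case {g} g∈Y g∉Q (h , h∈Y , h∉X , h≢g , ser) with ⊆⇒Gap Q⊆Y
    ... | zero , G = contradiction (subst (g ∈_) (sym (gap-zero G)) g∈Y) g∉Q
    ... | suc zero , G = contradiction (subst (h ∈_) (sym (gap-zero (gap-del g∈Y g∉Q G))) (∈-del h≢g h∈Y))
            (series∉Q g∈Y g∉Q h∈Y h∉X h≢g ser)
    ... | suc (suc l) , G = mw-subst {a′ = 2 ^ (2 + l) + 1 * (2 * geometric 2 (1 + l))} {b′ = 0 + geometric 2 (2 + k) * 2} {c′ = 1 + (2 + k) * (2 + l)}
      (trans (expansion 1 1) (cong₂ _+_ (trans (t-free 1 1 (gap-Z G) rZ-free) (^-zeroˡ (2 + l)))
        (cong₂ _*_ (geometric-1 (2 + k)) (trans (t-circuit 1 1 G rY-circuit clQY) (geometric-1 (2 + l))))))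
      (trans (expansion 2 0) (cong₂ _+_ (t-free 2 0 (gap-Z G) rZ-free) (cong (1 *_) (t-circuit 2 0 G rY-circuit clQY))))
      (trans (expansion 0 2) (cong₂ _+_ (t-free 0 2 (gap-Z G) rZ-free) (cong (geometric 2 (2 + k) *_) (t-circuit 0 2 G rY-circuit clQY))))
      (thick-circuit-bound k l)
      where
      h∉Q : h ∉ Q
      h∉Q = series∉Q g∈Y g∉Q h∈Y h∉X h≢g ser
      V : Subset n
      V = del h (del g Y)
      rY : r Y ≡ suc (r V)
      rY = trans (sym (clQY g∈Y g∉Q)) ser
      rV : r V ≡ l + r Q
      rV = nonspanning⇒free split (gap-del (∈-del h≢g h∈Y) h∉Q (gap-del g∈Y g∉Q G))
        (λ i∈V → llQY (del⁻ g Y (del⁻ h _ i∈V))) dependent-Q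
        (≤-trans (≤-reflexive (sym rY)) (r-mono (⊆-max Y)))
      rY-circuit : r Y ≡ suc l + r Q
      rY-circuit = trans rY (cong suc rV)
      rZ-free : r Z ≡ 2 + l + r X
      rZ-free = trans rZ (trans rY-circuit (trans (cong (suc l +_) rQ) (+-suc (suc l) (r X))))

    -- A parallel pair `g`, `h` outside `Q` stays parallel over `Q`, so the excluded minor bounds
    -- the rank of the whole matroid by `suc (r Q)`. The induction hypothesis handles `Z`, which has
    -- no coloops because parallel partners of its elements stay in it.
    rank-2-case : (∀ {g} → g ∈ Y → g ∉ Q → HasParallel X Y g) → MW X Y
    rank-2-case par with ⊆⇒Gap Q⊆Y
    ... | zero , G = contradiction (trans rZ (cong r (sym (gap-zero G)))) (<⇒≢ (≤-<-trans
            (r-mono (λ i∈Z → Z∩Q⊆X i∈Z (subst (_ ∈_) (sym (gap-zero G)) (Z⊆Y i∈Z)))) (≤-reflexive (sym rQ))))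
    ... | suc m , G
      with g , g∈Y , g∉Q ← gap-suc G
      with h , h∈Y , h∉X , h≢g , g∥h ← par g∈Y g∉Q = conclude m G (2≤m G)
      where
      h∉Q : h ∉ Q
      h∉Q = parallel∉Q g∈Y g∉Q h∈Y h∉X g∥h
      rY : r Y ≡ suc (r Q)
      rY = ≤-antisym
        (≤-trans (r-mono (⊆-max Y)) (split Q g h g∉Q h∉Q (h≢g ∘ sym) dependent-Q (llQY g∈Y g∉Q) (llQY h∈Y h∉Q)
          (trans (loop-⊆ (add-⊆ (x∈add g Q) (∈-add g ∘ X⊆Q)) g∥h) (llQY g∈Y g∉Q))))
        (≤-trans (≤-reflexive (sym (llQY g∈Y g∉Q))) (r-mono (add-⊆ g∈Y Q⊆Y)))
      clXZ : Coloopless X Z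
      clXZ {i} i∈Z i∉X with j , j∈Y , j∉X , j≢i , i∥j ← par (Z⊆Y i∈Z) (λ i∈Q → i∉X (Z∩Q⊆X i∈Z i∈Q)) =
        noncoloop i∈Z (add-⊆ (∈-del j≢i j∈Z) (⊆-del i∉X X⊆Z)) (parallel-sym (Z⊆Y i∈Z) i∉X j∈Y j∉X i∥j)
        where
        j∈Z : j ∈ Z
        j∈Z = decidable-stable (j ∈? Z) (λ j∉Z →
          parallel∉Q (Z⊆Y i∈Z) (λ i∈Q → i∉X (Z∩Q⊆X i∈Z i∈Q)) j∈Y j∉X i∥j (Y⊆Z∪Q j∈Y j∉Z))
      2≤m : ∀ {m} → Gap Q (suc m) Y → 2 ≤ m
      -- `Z` over `X` has `suc m` elements, rank 2 and no coloops, hence at least three elements.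
      -- This excludes the size at which the numerical estimate fails.
      2≤m {m} G with i , i∈Z , i∉X ← gap-suc (gap-Z G) = +-cancelʳ-≤ (r X + ∣ X ∣) 2 m
        (subst₂ _≤_ (cong (_+ ∣ X ∣) (trans (clXZ i∈Z i∉X) (trans rZ (trans rY (cong suc rQ)))))
          (trans (cong (r X +_) (card-of (gap-del i∈Z i∉X (gap-Z G)))) (d m (r X) ∣ X ∣))
          (r-card (⊆-del i∉X X⊆Z)))
        where
        d : ∀ m a b → a + (m + b) ≡ m + (a + b)
        d = solve-∀
      conclude : ∀ m → Gap Q (suc m) Y → 2 ≤ m → MW X Y
      -- Over `Q` the whole of `Y` is a single parallel class, so its expansion is the product case
      -- with an empty remaining factor.
      conclude (suc (suc l)) G (s≤s (s≤s _)) = cases (parallel-class G (λ i → i) rY llQY)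
        where
        smaller : 3 + l < N
        smaller = subst (3 + l <_) (sym (gap-sum X⊆Q-gap G X⊆Y)) (m<m+n (3 + l) z<s)
        cases : (∃ λ Z′ → IsDifference Q Z′ Y Y × ∣ Y ∣ ≡ 3 + l + ∣ Z′ ∣ × ParallelExpansion (2 + l) Q Z′ Y Y) → MW X Y
        cases (Z′ , diff′ , _ , inj₂ (rZ′ , _)) = contradiction rZ′ (<⇒≢ (≤-<-trans
              (r-mono (λ i∈Z′ → IsDifference.Z∩Q⊆X diff′ i∈Z′ (IsDifference.Z⊆Y diff′ i∈Z′))) (≤-reflexive (sym rY))))
        cases (Z′ , _ , _ , inj₁ (_ , uniform)) = mw-subst {a′ = t 2 0 X Z + 1 * 2} {b′ = t 0 2 X Z + geometric 2 (2 + k) * (2 * geometric 2 (2 + l))} {c′ = t 1 1 X Z + (2 + k) * (3 + l)}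
          (trans (expansion 1 1) (cong (t 1 1 X Z +_) (cong₂ _*_ (geometric-1 (2 + k)) (trans (eval 1 1) (geometric-1 (3 + l))))))
          (trans (expansion 2 0) (cong (λ z → t 2 0 X Z + 1 * z) (eval 2 0)))
          (trans (expansion 0 2) (cong (λ z → t 0 2 X Z + geometric 2 (2 + k) * z) (eval 0 2)))
          (rank-2-bound k l {t 2 0 X Z} {t 0 2 X Z} {t 1 1 X Z} (IH smaller (gap-Z G) (λ i∈Z → ll (Z⊆Y i∈Z)) clXZ))
          where
          eval : ∀ x y → t x y Q Y ≡ x + y * geometric y (2 + l)
          eval x y = trans (uniform x y) (trans (cong ((x + y * geometric y (2 + l)) *_) (t-empty x y Y)) (*-identityʳ _))

  conclusion : MW X Y
  conclusion = cases (parallel-class X⊆Q-gap Q⊆Y rQ llXQ)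
    where
    cases : (∃ λ Z → IsDifference X Z Q Y × ∣ Y ∣ ≡ 2 + k + ∣ Z ∣ × ParallelExpansion (1 + k) X Z Q Y) → MW X Y
    cases (Z , _ , _ , inj₁ (_ , product)) = mw-subst {a′ = 2 * t 2 0 Q Y} {b′ = 2 * geometric 2 (1 + k) * t 0 2 Q Y} {c′ = (2 + k) * t 1 1 Q Y}
      (trans (product 1 1) (cong (_* t 1 1 Q Y) (geometric-1 (2 + k)))) (product 2 0) (product 0 2)
      (direct-sum-bound k {t 2 0 Q Y} {t 0 2 Q Y} {t 1 1 Q Y} (IH smaller Q⊆Y-gap llQY clQY))
      where
      M : ℕ
      M = proj₁ (⊆⇒Gap Q⊆Y)
      Q⊆Y-gap : Gap Q M Y
      Q⊆Y-gap = proj₂ (⊆⇒Gap Q⊆Y)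
      smaller : M < N
      smaller = subst (M <_) (sym (gap-sum X⊆Q-gap Q⊆Y-gap X⊆Y)) (m<m+n M z<s)
    cases (Z , diff , sizeZ , inj₂ (rZ , expansion))
      with Fin.any? (λ g → (g ∈? Y) ×-dec ¬? (g ∈? Q) ×-dec hasSeries? X Y g)
    ... | yes (g , g∈Y , g∉Q , ser) = circuit-case diff sizeZ rZ expansion g∈Y g∉Q ser
    ... | no none = rank-2-case diff sizeZ rZ expansion λ g∈Y g∉Q →
           [ (λ p → p) , (λ ser → contradiction (_ , g∈Y , g∉Q , ser) none) ]′ (paired g∈Y (∉Q⇒∉X g∉Q))

-- Transfer to the dual, and the induction

module _ {n : ℕ} (R : Rank n) where
  open Partners R
  private module Dual = Partners (dual R)

  module _ {X Y : Subset n} where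
    dual-gap : ∀ {N} → Gap X N Y → Gap (∁ Y) N (∁ X)
    dual-gap {N} (gap X⊆Y size) = gap (p⊆q⇒∁p⊇∁q X⊆Y) (+-cancelˡ-≡ ∣ X ∣ _ _ (begin
      ∣ X ∣ + ∣ ∁ X ∣          ≡⟨ trans (∣∁∣ X) (sym (∣∁∣ Y)) ⟩
      ∣ Y ∣ + ∣ ∁ Y ∣          ≡⟨ cong (_+ ∣ ∁ Y ∣) size ⟩
      N + ∣ X ∣ + ∣ ∁ Y ∣      ≡⟨ d N ∣ X ∣ ∣ ∁ Y ∣ ⟩
      ∣ X ∣ + (N + ∣ ∁ Y ∣)    ∎))
      where
      open ≡-Reasoning
      d : ∀ a b c → a + b + c ≡ b + (a + c)
      d = solve-∀

    dual-loopless : Coloopless X Y → Dual.Loopless (∁ Y) (∁ X)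
    dual-loopless cl {e} e∈ e∉
      rewrite ∣add∣ e∉ | ∁-add e (∁ Y) | ∁-involutive Y | cl (x∉∁p⇒x∈p e∉) (x∈∁p⇒x∉p e∈) = refl

    dual-coloopless : Loopless X Y → Dual.Coloopless (∁ Y) (∁ X)
    dual-coloopless ll {e} e∈ e∉
      rewrite ∣del∣ e∈ | ∁-del e (∁ X) | ∁-involutive X | ll (x∉∁p⇒x∈p e∉) (x∈∁p⇒x∉p e∈) = +-suc ∣ del e (∁ X) ∣ (r X)

    dual-series : ∀ {e} → HasSeries X Y e → Dual.HasParallel (∁ Y) (∁ X) e
    dual-series {e} (f , f∈Y , f∉X , f≢e , p) = f , x∉p⇒x∈∁p f∉X , x∈p⇒x∉∁p f∈Y , f≢e , parallel
      where
      parallel : ∣ add f (add e (∁ Y)) ∣ + r (∁ (add f (add e (∁ Y)))) ≡ ∣ add e (∁ Y) ∣ + r (∁ (add e (∁ Y)))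
      parallel rewrite ∁-add f (add e (∁ Y)) | ∁-add e (∁ Y) | ∁-involutive Y
        | ∣add∣ (∉-add f≢e (x∈p⇒x∉∁p f∈Y)) | p = sym (+-suc ∣ add e (∁ Y) ∣ _)

    dual-MW : X ⊆ Y → Dual.MW (∁ Y) (∁ X) → MW X Y
    dual-MW X⊆Y h = subst (t 1 1 X Y * t 1 1 X Y ≤_) (*-comm (t 0 2 X Y) (t 2 0 X Y))
      (mw-subst (swap 1 1) (swap 2 0) (swap 0 2) h)
      where
      swap : ∀ x y → t y x X Y ≡ Dual.t x y (∁ Y) (∁ X)
      swap x y = sym (trans (t-dual R x y (p⊆q⇒∁p⊇∁q X⊆Y)) (cong₂ (t y x) (∁-involutive X) (∁-involutive Y)))

-- `B` bounds the size strictly, which gives strong induction: removing a parallel class drops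
-- several elements at once. The rank function is quantified inside, since the induction hypothesis
-- is also applied to `dual R`.
merino-welsh-minor : ∀ B {n} (R : Rank n) → ElementarySplit R → ∀ {N X Y} → N < B → Gap X N Y →
  Minors.Loopless R X Y → Minors.Coloopless R X Y → Partners.MW R X Y
merino-welsh-minor (suc B) {n} R split {N} {X} {Y} (s≤s N≤B) X⊆Y ll cl
  with Fin.any? (λ e → (e ∈? Y) ×-dec ¬? (e ∈? X) ×-dec ¬? (Partners.hasParallel? R X Y e) ×-dec ¬? (Partners.hasSeries? R X Y e))
... | yes (e , e∈Y , e∉X , ¬par , ¬ser) = delete-contract N N≤B X⊆Y
  where
  open Partners R
  delete-contract : ∀ N → N ≤ B → Gap X N Y → MW X Y
  delete-contract zero _ G = contradiction (subst (e ∈_) (sym (gap-zero G)) e∈Y) e∉X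
  delete-contract (suc N) N<B G = mw-subst (delcon 1 1) (delcon 2 0) (delcon 0 2)
    (cauchy-schwarz {t 2 0 (add e X) Y} {t 0 2 (add e X) Y} {t 1 1 (add e X) Y}
      (merino-welsh-minor B R split N<B (gap-add e∈Y e∉X G) contract-loopless (λ g∈Y g∉ → cl g∈Y (g∉ ∘ ∈-add e)))
      (merino-welsh-minor B R split N<B (gap-del e∈Y e∉X G) (λ g∈ → ll (del⁻ e Y g∈)) delete-coloopless))
    where
    delcon : ∀ x y → t x y X Y ≡ t x y (add e X) Y + t x y X (del e Y)
    delcon x y = t-delcon x y (⊆-of G) e∈Y e∉X (ll e∈Y e∉X) (cl e∈Y e∉X)
    contract-loopless : Loopless (add e X) Y
    contract-loopless g∈Y g∉ = nonloop λ p → ¬par (_ , g∈Y , g∉ ∘ ∈-add e , (λ { refl → g∉ (x∈add e X) }) , p)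
    delete-coloopless : Coloopless X (del e Y)
    delete-coloopless g∈ g∉X with del-dichotomy (del e Y) g∈
    ... | inj₁ p = p
    ... | inj₂ p = contradiction (_ , del⁻ e Y g∈ , g∉X , ∈del⇒≢ Y g∈ , p) ¬ser
... | no allPaired with Fin.any? (λ e → (e ∈? Y) ×-dec ¬? (e ∈? X) ×-dec Partners.hasParallel? R X Y e)
...   | yes (e , e∈Y , e∉X , f , f∈Y , f∉X , f≢e , e∥f) =
  AllPaired.conclusion R split X⊆Y ll cl (λ M<N → merino-welsh-minor B R split (<-≤-trans M<N N≤B))
    paired e∈Y e∉X f∈Y f∉X f≢e e∥f
  where
  open Partners R
  paired : ∀ {g} → g ∈ Y → g ∉ X → HasParallel X Y g ⊎ HasSeries X Y g
  paired {g} g∈Y g∉X with hasParallel? X Y g | hasSeries? X Y g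
  ... | yes p | _ = inj₁ p
  ... | no _ | yes s = inj₂ s
  ... | no ¬p | no ¬s = contradiction (g , g∈Y , g∉X , ¬p , ¬s) allPaired
...   | no noParallel with ⊆⇒≡⊎∃ X Y (⊆-of X⊆Y)
...     | inj₁ refl = mw-subst {a′ = 1} {1} {1} (t-empty 1 1 X) (t-empty 2 0 X) (t-empty 0 2 X) ≤-refl
  where open Partners R
-- Without parallel partners every element has a series partner, so in the dual every element has a
-- parallel one.
...     | inj₂ (e , e∈Y , e∉X) = from-dual (dual-series R (series e∈Y e∉X))
  where
  open Partners R
  series : ∀ {g} → g ∈ Y → g ∉ X → HasSeries X Y g
  series {g} g∈Y g∉X with hasSeries? X Y g
  ... | yes s = s
  ... | no ¬s = contradiction (g , g∈Y , g∉X , (λ p → noParallel (g , g∈Y , g∉X , p)) , ¬s) allPaired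
  from-dual : Partners.HasParallel (dual R) (∁ Y) (∁ X) e → MW X Y
  from-dual (f , f∈ , f∉ , f≢e , e∥f) = dual-MW R (⊆-of X⊆Y)
    (AllPaired.conclusion (dual R) (dual-elementarySplit R split) (dual-gap R X⊆Y) (dual-loopless R cl) (dual-coloopless R ll)
      (λ M<N → merino-welsh-minor B (dual R) (dual-elementarySplit R split) (<-≤-trans M<N N≤B))
      (λ g∈ g∉ → inj₁ (dual-series R (series (x∉∁p⇒x∈p g∉) (x∈∁p⇒x∉p g∈))))
      (x∉p⇒x∈∁p e∉X) (x∈p⇒x∉∁p e∈Y) f∈ f∉ f≢e e∥f)

-- Cyclic flats

matroidRank : ∀ {n} → Matroid n → Rank n
matroidRank {n} M = record
  { r = rank
  ; r-≤-add = λ x X → rank-mono X (add x X) (⊆-add x X)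
  ; r-add-≤ = λ x X → begin
      rank (add x X)                                 ≡⟨ cong rank (∪⁅⁆≡add x X) ⟨
      rank (X ∪ ⁅ x ⁆)                               ≤⟨ m≤m+n _ _ ⟩
      rank (X ∪ ⁅ x ⁆) + rank (X ∩ ⁅ x ⁆)            ≤⟨ rank-sub X ⁅ x ⁆ ⟩
      rank X + rank ⁅ x ⁆                            ≤⟨ +-monoʳ-≤ (rank X) (rank-card ⁅ x ⁆) ⟩
      rank X + ∣ ⁅ x ⁆ ∣                             ≡⟨ cong (rank X +_) (∣⁅x⁆∣≡1 x) ⟩
      rank X + 1                                     ≡⟨ +-comm (rank X) 1 ⟩
      suc (rank X)                                   ∎
  ; r-diminishing = λ x {X} {Y} X⊆Y → ≤-trans
      (+-mono-≤
        (rank-mono (add x Y) (add x X ∪ Y) (add-⊆ (p⊆p∪q Y (x∈add x X)) (q⊆p∪q (add x X) Y)))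
        (rank-mono X (add x X ∩ Y) (λ i∈X → x∈p∩q⁺ (∈-add x i∈X , X⊆Y i∈X))))
      (rank-sub (add x X) Y)
  }
  where
  open Matroid M
  open ≤-Reasoning

module _ {n : ℕ} (M : Matroid n) where
  open Matroid M using (rank; rank-card)
  open RankTheory (matroidRank M)

  rank-⊥ : rank ⊥ ≡ 0
  rank-⊥ = n≤0⇒n≡0 (subst (rank ⊥ ≤_) (∣⊥∣≡0 n) (rank-card ⊥))

  independent-⊆ : ∀ {A B} → A ⊆ B → Independent M B → Independent M A
  independent-⊆ {A} {B} A⊆B ind = ≤-antisym (rank-card A)
    (+-cancelˡ-≤ ∣ B ∣ _ _ (subst₂ _≤_ (cong (_+ ∣ A ∣) ind) (+-comm (rank A) ∣ B ∣) (r-card A⊆B)))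

  redundant : ∀ {X} → Dependent M X → ∃ λ x → x ∈ X × r (del x X) ≡ r X
  redundant {X} dep = dependent⇒∃ X (<-≤-trans dep (m≤m+n ∣ X ∣ (r ⊥)))

  -- `I` is shrunk while it still spans `x`. A minimal such set is independent, because a redundant
  -- element could be dropped, and together with `x` it is a circuit.
  circuit-through : ∀ N {x I} → ∣ I ∣ ≡ N → x ∉ I → r (add x I) ≡ r I → ∃ λ C → Circuit M C × x ∈ C × C ⊆ add x I
  circuit-through N {x} {I} size x∉I loop with Fin.any? (λ y → (y ∈? I) ×-dec (r (add x (del y I)) ≟ r (del y I)))
  circuit-through zero {x} {I} size x∉I loop | yes (y , y∈I , _) = contradiction (trans (sym (∣del∣ y∈I)) size) λ ()
  circuit-through (suc N) {x} {I} size x∉I loop | yes (y , y∈I , loop′)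
    with circuit-through N (suc-injective (trans (sym (∣del∣ y∈I)) size)) (∉-del y x∉I) loop′
  ... | C , circuit , x∈C , C⊆ = C , circuit , x∈C , add-⊆ (x∈add x I) (∈-add x ∘ del⁻ y I) ∘ C⊆
  circuit-through N {x} {I} size x∉I loop | no minimal = add x I , (dependent , proper) , x∈add x I , λ i → i
    where
    dependent : Dependent M (add x I)
    dependent = subst₂ _<_ (sym loop) (sym (∣add∣ x∉I)) (s≤s (rank-card I))
    I-independent : Independent M I
    I-independent with m≤n⇒m<n∨m≡n (rank-card I)
    ... | inj₂ ind = ind
    ... | inj₁ dep with y , y∈I , p ← redundant dep = contradiction (y , y∈I , ≤-antisym
          (≤-trans (r-mono (add-⊆ (x∈add x I) (∈-add x ∘ del⁻ y I))) (≤-reflexive (trans loop (sym p))))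
          (r-≤-add x (del y I))) minimal
    del-independent : ∀ {z} → z ∈ add x I → Independent M (del z (add x I))
    del-independent {z} z∈ with z Fin.≟ x
    ... | yes refl = subst (Independent M) (sym (del-add x∉I)) I-independent
    ... | no z≢x = subst (Independent M) (add-del-comm I (z≢x ∘ sym)) (begin
        r (add x (del z I))      ≡⟨ nonloop (λ p → minimal (z , [ (λ z≡x → contradiction z≡x z≢x) , (λ i → i) ]′ (add⁻ x I z∈) , p)) ⟩
        suc (r (del z I))        ≡⟨ cong suc (independent-⊆ (del-⊆ z I) I-independent) ⟩
        suc ∣ del z I ∣          ≡⟨ ∣add∣ (∉-del z x∉I) ⟨
        ∣ add x (del z I) ∣      ∎)
      where open ≡-Reasoning
    proper : ∀ D → D ⊂ add x I → Independent M D
    proper D (D⊆ , z , z∈ , z∉D) = independent-⊆ (⊆-del z∉D D⊆) (del-independent z∈)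

  closure : Subset n → Subset n
  closure S = comprehension (λ x → r (add x S) ≟ r S)

  -- `L` without the coloops of the restriction to `L`; applied to a flat it yields a cyclic flat.
  cyclicPart : Subset n → Subset n
  cyclicPart L = comprehension (λ x → (x ∈? L) ×-dec (r (del x L) ≟ r L))

  ∈-closure⁺ : ∀ {S x} → r (add x S) ≡ r S → x ∈ closure S
  ∈-closure⁺ {S} = ∈-comprehension⁺ (λ x → r (add x S) ≟ r S)

  ∈-closure⁻ : ∀ {S x} → x ∈ closure S → r (add x S) ≡ r S
  ∈-closure⁻ {S} = ∈-comprehension⁻ (λ x → r (add x S) ≟ r S)

  ∈-cyclicPart⁺ : ∀ {L x} → x ∈ L → r (del x L) ≡ r L → x ∈ cyclicPart L
  ∈-cyclicPart⁺ {L} x∈L p = ∈-comprehension⁺ (λ x → (x ∈? L) ×-dec (r (del x L) ≟ r L)) (x∈L , p)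

  ∈-cyclicPart⁻ : ∀ {L x} → x ∈ cyclicPart L → x ∈ L × r (del x L) ≡ r L
  ∈-cyclicPart⁻ {L} = ∈-comprehension⁻ (λ x → (x ∈? L) ×-dec (r (del x L) ≟ r L))

  ⊆-closure : ∀ S → S ⊆ closure S
  ⊆-closure S x∈S = ∈-closure⁺ (cong r (add-∈ x∈S))

  rank-closure : ∀ S → r (closure S) ≡ r S
  rank-closure S = closure-rank (⊆-closure S) (λ x x∈ → ∈-closure⁻ x∈)

  closure-flat : ∀ S x → x ∉ closure S → r (add x (closure S)) ≡ suc (r (closure S))
  closure-flat S x x∉ = nonloop λ loop → x∉ (∈-closure⁺ (≤-antisym
    (≤-trans (r-mono (add-⊆ (x∈add x (closure S)) (∈-add x ∘ ⊆-closure S))) (≤-reflexive (trans loop (rank-closure S))))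
    (r-≤-add x S)))

  module _ {L : Subset n} (flat : ∀ x → x ∉ L → r (add x L) ≡ suc (r L)) where
    private
      C⊆L : cyclicPart L ⊆ L
      C⊆L = proj₁ ∘ ∈-cyclicPart⁻

    cyclicPart-flat : Flat M (cyclicPart L)
    cyclicPart-flat x x∉ = subst (λ Z → r (cyclicPart L) < r Z) (sym (∪⁅⁆≡add x (cyclicPart L))) (≤-reflexive (sym raise))
      where
      raise : r (add x (cyclicPart L)) ≡ suc (r (cyclicPart L))
      raise with x ∈? L
      ... | no x∉L = nonloop-⊆ C⊆L (flat x x∉L)
      ... | yes x∈L with del-dichotomy L x∈L
      ...   | inj₁ p = contradiction (∈-cyclicPart⁺ x∈L p) x∉
      ...   | inj₂ coloop = coloop⇒add x∈L coloop (⊆-del x∉ C⊆L)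

    cyclicPart-cyclic : UnionOfCircuits M (cyclicPart L)
    cyclicPart-cyclic x x∈ with x∈L , p ← ∈-cyclicPart⁻ x∈
      with C , (dep , proper) , x∈C , C⊆ ← circuit-through _ refl (x∉del x L) (trans (cong r (add-del x∈L)) (sym p)) =
      C , (dep , proper) , C⊆cyclic , x∈C
      where
      C⊆L′ : C ⊆ L
      C⊆L′ = subst (_ ∈_) (add-del x∈L) ∘ C⊆
      C⊆cyclic : C ⊆ cyclicPart L
      -- Each element of the circuit is spanned by the others, so it is not a coloop of `L`.
      C⊆cyclic {c} c∈C = ∈-cyclicPart⁺ (C⊆L′ c∈C) (noncoloop (C⊆L′ c∈C) (⊆-del (x∉del c C) (C⊆L′ ∘ del⁻ c C))
        (trans (cong r (add-del c∈C)) (≤-antisym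
          (s≤s⁻¹ (≤-trans dep (≤-reflexive (trans (∣del∣ c∈C) (cong suc (sym (proper (del c C) (del-⊆ c C , c , c∈C , x∉del c C))))))))
          (r-del-≤ c C))))

  closure-cyclicFlat : ∀ S → CyclicFlat M (cyclicPart (closure S))
  closure-cyclicFlat S = cyclicPart-flat (closure-flat S) , cyclicPart-cyclic (closure-flat S)

  -- The excluded minor on X, f, g produces the cyclic flats ∅ ≠ cyclicPart (cl X) ⊂ cyclicPart (cl (X + f)) ≠ E.
  connectedSplit⇒elementarySplit : ConnectedSplit M → ElementarySplit (matroidRank M)
  connectedSplit⇒elementarySplit (_ , clutter) X f g f∉X g∉X f≢g dep rf rg rfg = ≮⇒≥ λ nonspanning →
    [ F₁≢⊥ , F₂≢⊤ nonspanning ]′ (clutter F₁ F₂ (closure-cyclicFlat X) (closure-cyclicFlat (add f X)) (F₁⊆F₂ , f , f∈F₂ , f∉F₁))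
    where
    L₁ L₂ F₁ F₂ : Subset n
    L₁ = closure X
    L₂ = closure (add f X)
    F₁ = cyclicPart L₁
    F₂ = cyclicPart L₂
    L₁⊆L₂ : L₁ ⊆ L₂
    L₁⊆L₂ x∈ = ∈-closure⁺ (loop-⊆ (⊆-add f X) (∈-closure⁻ x∈))
    F₁⊆F₂ : F₁ ⊆ F₂
    F₁⊆F₂ {x} x∈ with x∈L₁ , p ← ∈-cyclicPart⁻ x∈ = ∈-cyclicPart⁺ (L₁⊆L₂ x∈L₁)
      (noncoloop (L₁⊆L₂ x∈L₁) (⊆-del (x∉del x L₁) (L₁⊆L₂ ∘ del⁻ x L₁)) (trans (cong r (add-del x∈L₁)) (sym p)))
    f∈L₂ : f ∈ L₂
    f∈L₂ = ⊆-closure (add f X) (x∈add f X)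
    g∈L₂ : g ∈ L₂
    g∈L₂ = ∈-closure⁺ (trans rfg (sym rf))
    f∈F₂ : f ∈ F₂
    -- `f` is spanned by `X` and `g`, both inside `L₂`, so it is not a coloop there.
    f∈F₂ = ∈-cyclicPart⁺ f∈L₂ (noncoloop f∈L₂
      (add-⊆ (∈-del (f≢g ∘ sym) g∈L₂) (⊆-del f∉X (⊆-closure (add f X) ∘ ∈-add f)))
      (trans (cong r (add-comm f g X)) (trans rfg (sym rg))))
    f∉F₁ : f ∉ F₁
    f∉F₁ f∈ = 1+n≢n (trans (sym rf) (∈-closure⁻ (proj₁ (∈-cyclicPart⁻ f∈))))
    F₁≢⊥ : ¬ (F₁ ≡ ⊥)
    F₁≢⊥ F₁≡⊥ with x , x∈X , p ← dependent⇒∃ X dep = ∉⊥ (subst (x ∈_) F₁≡⊥ (∈-cyclicPart⁺ (⊆-closure X x∈X)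
      (noncoloop (⊆-closure X x∈X) (⊆-del (x∉del x X) (⊆-closure X ∘ del⁻ x X)) (trans (cong r (add-del x∈X)) (sym p)))))
    F₂≢⊤ : suc (r X) < r ⊤ → ¬ (F₂ ≡ ⊤)
    F₂≢⊤ nonspanning F₂≡⊤ = <⇒≱ nonspanning (≤-trans
      (r-mono (λ {x} x∈ → proj₁ (∈-cyclicPart⁻ (subst (x ∈_) (sym F₂≡⊤) x∈))))
      (≤-reflexive (trans (rank-closure (add f X)) rf)))

  -- A dependent set of a uniform matroid already has full rank, so no `f` can raise it.
  uniform⇒elementarySplit : Uniform M → ElementarySplit (matroidRank M)
  uniform⇒elementarySplit (ρ , uniform) X f g f∉X _ _ dep rf _ _ = contradiction
    (≤-trans (≤-reflexive (sym rf)) (≤-trans (≤-reflexive (uniform (add f X))) (m⊓n≤m ρ _)))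
    (<⇒≱ (s≤s (≤-reflexive (sym (trans (uniform X) (m≤n⇒m⊓n≡m (≮⇒≥ λ ∣X∣<ρ →
      <-irrefl (sym (+-identityʳ ∣ X ∣)) (subst₂ _<_ (trans (uniform X) (m≥n⇒m⊓n≡n (<⇒≤ ∣X∣<ρ))) (cong (∣ X ∣ +_) rank-⊥) dep))))))))

-- Direct sums and isomorphisms

sumℤ-++ : ∀ xs ys → sumℤ (xs List.++ ys) ≡ sumℤ xs ℤ.+ sumℤ ys
sumℤ-++ List.[] ys = sym (ℤ.+-identityˡ (sumℤ ys))
sumℤ-++ (x List.∷ xs) ys = trans (cong (λ s → x ℤ.+ s) (sumℤ-++ xs ys)) (sym (ℤ.+-assoc x (sumℤ xs) (sumℤ ys)))

sumℤ-allSubsets : ∀ n (f : Subset n → ℤ) → sumℤ (List.map f (allSubsets n)) ≡ ∑ ⊥ ⊤ f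
sumℤ-allSubsets zero f = ℤ.+-identityʳ (f [])
sumℤ-allSubsets (suc n) f = begin
  sumℤ (List.map f (List.map (true ∷_) (allSubsets n) List.++ List.map (false ∷_) (allSubsets n)))
    ≡⟨ cong sumℤ (List.map-++ f (List.map (true ∷_) (allSubsets n)) _) ⟩
  sumℤ (List.map f (List.map (true ∷_) (allSubsets n)) List.++ List.map f (List.map (false ∷_) (allSubsets n)))
    ≡⟨ sumℤ-++ (List.map f (List.map (true ∷_) (allSubsets n))) _ ⟩
  sumℤ (List.map f (List.map (true ∷_) (allSubsets n))) ℤ.+ sumℤ (List.map f (List.map (false ∷_) (allSubsets n)))
    ≡⟨ cong₂ ℤ._+_ (half true) (half false) ⟩
  ∑ ⊥ ⊤ (f ∘ (true ∷_)) ℤ.+ ∑ ⊥ ⊤ (f ∘ (false ∷_)) ∎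
  where
  open ≡-Reasoning
  half : ∀ b → sumℤ (List.map f (List.map (b ∷_) (allSubsets n))) ≡ ∑ ⊥ ⊤ (f ∘ (b ∷_))
  half b = trans (cong sumℤ (sym (List.map-∘ (allSubsets n)))) (sumℤ-allSubsets n (f ∘ (b ∷_)))

rankTerm : RankFn n → ℤ → ℤ → Subset n → ℤ
rankTerm ρ u v A = u ℤ.^ (ρ ⊤ ∸ ρ A) ℤ.* v ℤ.^ (∣ A ∣ ∸ ρ A)

rankTutte : RankFn n → ℤ → ℤ → ℤ
rankTutte ρ u v = ∑ ⊥ ⊤ (rankTerm ρ u v)

∑-cong′ : ∀ {f g : Subset n → ℤ} → (∀ A → f A ≡ g A) → ∑ ⊥ ⊤ f ≡ ∑ ⊥ ⊤ g
∑-cong′ h = ∑-cong (⊆-min ⊤) (λ A _ _ → h A)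

tutte≡rankTutte : ∀ (M : Matroid n) x y → tutte M x y ≡ rankTutte (Matroid.rank M) (x ℤ.- 1ℤ) (y ℤ.- 1ℤ)
tutte≡rankTutte {n} M x y = sumℤ-allSubsets n _

rankTutte≡T : ∀ (M : Matroid n) u v → rankTutte (Matroid.rank M) u v ≡ Tutte.T (matroidRank M) u v ⊥ ⊤
rankTutte≡T {n} M u v = ∑-cong′ λ A → cong (λ k → u ℤ.^ (rank ⊤ ∸ rank A) ℤ.* v ℤ.^ k)
  (sym (cong₂ _∸_ (trans (cong (∣ A ∣ +_) (rank-⊥ M)) (+-identityʳ ∣ A ∣)) (cong (_+ rank A) (∣⊥∣≡0 n))))
  where open Matroid M

-- Written in the shifted coordinates `u = x - 1`, `v = y - 1`.
MerinoWelsh : RankFn n → Set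
MerinoWelsh ρ = rankTutte ρ 0ℤ 0ℤ ℤ.* rankTutte ρ 0ℤ 0ℤ ℤ.≤ rankTutte ρ 1ℤ (ℤ.- 1ℤ) ℤ.* rankTutte ρ (ℤ.- 1ℤ) 1ℤ

NoLoop NoColoop : RankFn n → Set
NoLoop ρ = ∀ e → ¬ (ρ ⁅ e ⁆ ≡ 0)
NoColoop ρ = ∀ e → ¬ (ρ (∁ ⁅ e ⁆) < ρ ⊤)

add-⊥ : ∀ (e : Fin n) → add e ⊥ ≡ ⁅ e ⁆
add-⊥ e = trans (sym (∪⁅⁆≡add e ⊥)) (∪-identityˡ ⁅ e ⁆)

del-⊤ : ∀ (e : Fin n) → del e ⊤ ≡ ∁ ⁅ e ⁆
del-⊤ e = trans (cong (del e) (sym ∁⊥≡⊤)) (trans (sym (∁-add e ⊥)) (cong ∁ (add-⊥ e)))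

elementarySplit⇒MerinoWelsh : ∀ (M : Matroid n) → ElementarySplit (matroidRank M) →
  NoLoop (Matroid.rank M) → NoColoop (Matroid.rank M) → MerinoWelsh (Matroid.rank M)
elementarySplit⇒MerinoWelsh {n} M split noLoop noColoop = subst₂ ℤ._≤_
  (trans (ℤ.pos-* (t 1 1 ⊥ ⊤) (t 1 1 ⊥ ⊤)) (cong₂ ℤ._*_ (eval 1 1) (eval 1 1)))
  (trans (ℤ.pos-* (t 2 0 ⊥ ⊤) (t 0 2 ⊥ ⊤)) (cong₂ ℤ._*_ (eval 2 0) (eval 0 2)))
  (ℤ.+≤+ (merino-welsh-minor (suc (proj₁ total)) (matroidRank M) split ≤-refl (proj₂ total) loopless coloopless))
  where
  open Minors (matroidRank M)
  total : ∃ λ N → Gap (⊥ {n}) N ⊤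
  total = ⊆⇒Gap (⊆-min ⊤)
  eval : ∀ x y → ℤ.+ t x y ⊥ ⊤ ≡ rankTutte (Matroid.rank M) (ℤ.+ x ℤ.- 1ℤ) (ℤ.+ y ℤ.- 1ℤ)
  eval x y = trans (+t x y (⊆-min ⊤)) (sym (rankTutte≡T M _ _))
  loopless : Loopless ⊥ ⊤
  loopless {e} _ _ = nonloop λ p → noLoop e (trans (cong r (sym (add-⊥ e))) (trans p (rank-⊥ M)))
  coloopless : Coloopless ⊥ ⊤
  coloopless {e} _ _ = ≤-antisym (r-del-≤ e ⊤) (≮⇒≥ λ lt → noColoop e (subst (λ A → r A < r ⊤) (del-⊤ e) lt))

∑-product : ∀ (f : Subset m → ℤ) (g : Subset n → ℤ) {h : Subset (m + n) → ℤ} → (∀ A B → h (A ++ B) ≡ f A ℤ.* g B) →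
  ∑ ⊥ ⊤ h ≡ ∑ ⊥ ⊤ f ℤ.* ∑ ⊥ ⊤ g
∑-product {zero} f g {h} eq = trans (∑-cong′ (eq [])) (∑-*ˡ ⊥ ⊤ (f []) g)
∑-product {suc m} f g {h} eq = trans
  (cong₂ ℤ._+_ (∑-product (f ∘ (true ∷_)) g (λ A B → eq (true ∷ A) B)) (∑-product (f ∘ (false ∷_)) g (λ A B → eq (false ∷ A) B)))
  (sym (ℤ.*-distribʳ-+ (∑ ⊥ ⊤ g) (∑ ⊥ ⊤ (f ∘ (true ∷_))) _))

-- Direct sums are treated as bare rank functions. These bounds make the truncated differences in
-- `rankTerm` exact, so exponents add over a direct sum.
record Bounded (ρ : RankFn n) : Set where
  field
    ≤-card : ∀ A → ρ A ≤ ∣ A ∣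
    ≤-top : ∀ A → ρ A ≤ ρ ⊤
open Bounded

matroid-bounded : ∀ (M : Matroid n) → Bounded (Matroid.rank M)
matroid-bounded M = record { ≤-card = rank-card ; ≤-top = λ A → rank-mono A ⊤ (⊆-max A) }
  where open Matroid M

bounded-⊥ : ∀ {ρ : RankFn n} → Bounded ρ → ρ ⊥ ≡ 0
bounded-⊥ {n} {ρ} b = n≤0⇒n≡0 (subst (ρ ⊥ ≤_) (∣⊥∣≡0 n) (≤-card b ⊥))

take-++ : ∀ (A : Subset m) (B : Subset n) → take m (A ++ B) ≡ A
take-++ {m} A B = ++-injectiveˡ (take m (A ++ B)) A (take++drop≡id m (A ++ B))

drop-++ : ∀ (A : Subset m) (B : Subset n) → drop m (A ++ B) ≡ B
drop-++ {m} A B = ++-injectiveʳ (take m (A ++ B)) A (take++drop≡id m (A ++ B))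

∣++∣ : ∀ (A : Subset m) (B : Subset n) → ∣ A ++ B ∣ ≡ ∣ A ∣ + ∣ B ∣
∣++∣ [] B = refl
∣++∣ (true ∷ A) B = cong suc (∣++∣ A B)
∣++∣ (false ∷ A) B = ∣++∣ A B

replicate-++ : ∀ m {n} (b : Bool) → replicate (m + n) b ≡ replicate m b ++ replicate n b
replicate-++ zero b = refl
replicate-++ (suc m) b = cong (b ∷_) (replicate-++ m b)

⁅↑ˡ⁆ : ∀ (i : Fin m) n → ⁅ i ↑ˡ n ⁆ ≡ ⁅ i ⁆ ++ ⊥
⁅↑ˡ⁆ {suc m} zero n = cong (true ∷_) (replicate-++ m false)
⁅↑ˡ⁆ (suc i) n = cong (false ∷_) (⁅↑ˡ⁆ i n)

⁅↑ʳ⁆ : ∀ m (i : Fin n) → ⁅ m ↑ʳ i ⁆ ≡ ⊥ {m} ++ ⁅ i ⁆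
⁅↑ʳ⁆ zero i = refl
⁅↑ʳ⁆ (suc m) i = cong (false ∷_) (⁅↑ʳ⁆ m i)

[m∸n]+[o∸p] : ∀ {m n o p} → n ≤ m → p ≤ o → (m + o) ∸ (n + p) ≡ (m ∸ n) + (o ∸ p)
[m∸n]+[o∸p] {m} {n} {o} {p} n≤m p≤o = m≡n+o⇒m∸n≡o (n + p)
  (trans (cong₂ _+_ (sym (m+[n∸m]≡n n≤m)) (sym (m+[n∸m]≡n p≤o))) (d n (m ∸ n) p (o ∸ p)))
  where
  d : ∀ a b c d → (a + b) + (c + d) ≡ (a + c) + (b + d)
  d = solve-∀

module _ {ρ₁ : RankFn m} {ρ₂ : RankFn n} (b₁ : Bounded ρ₁) (b₂ : Bounded ρ₂) where
  private
    ρ : RankFn (m + n)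
    ρ = ρ₁ ⊕ʳ ρ₂

  ⊕ʳ-++ : ∀ A B → ρ (A ++ B) ≡ ρ₁ A + ρ₂ B
  ⊕ʳ-++ A B = cong₂ _+_ (cong ρ₁ (take-++ A B)) (cong ρ₂ (drop-++ A B))

  ⊕ʳ-⊤ : ρ ⊤ ≡ ρ₁ ⊤ + ρ₂ ⊤
  ⊕ʳ-⊤ = trans (cong ρ (replicate-++ m true)) (⊕ʳ-++ ⊤ ⊤)

  ⊕ʳ-bounded : Bounded ρ
  ⊕ʳ-bounded = record
    { ≤-card = λ A → ≤-trans (+-mono-≤ (≤-card b₁ (take m A)) (≤-card b₂ (drop m A)))
        (≤-reflexive (trans (sym (∣++∣ (take m A) (drop m A))) (cong ∣_∣ (take++drop≡id m A))))
    ; ≤-top = λ A → ≤-trans (+-mono-≤ (≤-top b₁ (take m A)) (≤-top b₂ (drop m A))) (≤-reflexive (sym ⊕ʳ-⊤))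
    }

  rankTutte-⊕ʳ : ∀ u v → rankTutte ρ u v ≡ rankTutte ρ₁ u v ℤ.* rankTutte ρ₂ u v
  rankTutte-⊕ʳ u v = ∑-product (rankTerm ρ₁ u v) (rankTerm ρ₂ u v) λ A B → begin
    rankTerm ρ u v (A ++ B)
      ≡⟨ cong₂ (λ p q → u ℤ.^ p ℤ.* v ℤ.^ q)
           (trans (cong₂ _∸_ ⊕ʳ-⊤ (⊕ʳ-++ A B)) ([m∸n]+[o∸p] (≤-top b₁ A) (≤-top b₂ B)))
           (trans (cong₂ _∸_ (∣++∣ A B) (⊕ʳ-++ A B)) ([m∸n]+[o∸p] (≤-card b₁ A) (≤-card b₂ B))) ⟩
    u ℤ.^ ((ρ₁ ⊤ ∸ ρ₁ A) + (ρ₂ ⊤ ∸ ρ₂ B)) ℤ.* v ℤ.^ ((∣ A ∣ ∸ ρ₁ A) + (∣ B ∣ ∸ ρ₂ B))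
      ≡⟨ cong₂ ℤ._*_ (ℤ.^-distribˡ-+-* u (ρ₁ ⊤ ∸ ρ₁ A) _) (ℤ.^-distribˡ-+-* v (∣ A ∣ ∸ ρ₁ A) _) ⟩
    (u ℤ.^ (ρ₁ ⊤ ∸ ρ₁ A) ℤ.* u ℤ.^ (ρ₂ ⊤ ∸ ρ₂ B)) ℤ.* (v ℤ.^ (∣ A ∣ ∸ ρ₁ A) ℤ.* v ℤ.^ (∣ B ∣ ∸ ρ₂ B))
      ≡⟨ interchange (u ℤ.^ (ρ₁ ⊤ ∸ ρ₁ A)) (u ℤ.^ (ρ₂ ⊤ ∸ ρ₂ B)) (v ℤ.^ (∣ A ∣ ∸ ρ₁ A)) (v ℤ.^ (∣ B ∣ ∸ ρ₂ B)) ⟩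
    rankTerm ρ₁ u v A ℤ.* rankTerm ρ₂ u v B ∎
    where
    open ≡-Reasoning
    interchange : ∀ a b c d → (a ℤ.* b) ℤ.* (c ℤ.* d) ≡ (a ℤ.* c) ℤ.* (b ℤ.* d)
    interchange = ℤ.solve-∀

  MerinoWelsh-⊕ʳ : MerinoWelsh ρ₁ → MerinoWelsh ρ₂ → MerinoWelsh ρ
  MerinoWelsh-⊕ʳ h₁ h₂ rewrite rankTutte-⊕ʳ 0ℤ 0ℤ | rankTutte-⊕ʳ 1ℤ (ℤ.- 1ℤ) | rankTutte-⊕ʳ (ℤ.- 1ℤ) 1ℤ =
    product (rankTutte ρ₁ 0ℤ 0ℤ) (rankTutte ρ₂ 0ℤ 0ℤ) (rankTutte ρ₁ 1ℤ (ℤ.- 1ℤ)) (rankTutte ρ₂ 1ℤ (ℤ.- 1ℤ))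
      (rankTutte ρ₁ (ℤ.- 1ℤ) 1ℤ) (rankTutte ρ₂ (ℤ.- 1ℤ) 1ℤ) h₁ h₂
    where
    square-nonNegative : ∀ i → 0ℤ ℤ.≤ i ℤ.* i
    square-nonNegative (ℤ.+ i) = subst (0ℤ ℤ.≤_) (ℤ.pos-* i i) (ℤ.+≤+ z≤n)
    square-nonNegative (ℤ.-[1+ i ]) = ℤ.+≤+ z≤n
    interchange : ∀ a b c d → (a ℤ.* b) ℤ.* (c ℤ.* d) ≡ (a ℤ.* c) ℤ.* (b ℤ.* d)
    interchange = ℤ.solve-∀
    product : ∀ c₁ c₂ a₁ a₂ b₁ b₂ → c₁ ℤ.* c₁ ℤ.≤ a₁ ℤ.* b₁ → c₂ ℤ.* c₂ ℤ.≤ a₂ ℤ.* b₂ →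
      (c₁ ℤ.* c₂) ℤ.* (c₁ ℤ.* c₂) ℤ.≤ (a₁ ℤ.* a₂) ℤ.* (b₁ ℤ.* b₂)
    product c₁ c₂ a₁ a₂ b₁ b₂ h₁ h₂ = begin
      (c₁ ℤ.* c₂) ℤ.* (c₁ ℤ.* c₂)  ≡⟨ interchange c₁ c₂ c₁ c₂ ⟩
      (c₁ ℤ.* c₁) ℤ.* (c₂ ℤ.* c₂)  ≤⟨ ℤ.*-monoʳ-≤-nonNeg (c₂ ℤ.* c₂) {{ℤ.nonNegative (square-nonNegative c₂)}} h₁ ⟩
      -- The sign of `a₁ * b₁` comes from the first inequality itself, since it dominates a square.
      (a₁ ℤ.* b₁) ℤ.* (c₂ ℤ.* c₂)  ≤⟨ ℤ.*-monoˡ-≤-nonNeg (a₁ ℤ.* b₁) {{ℤ.nonNegative (ℤ.≤-trans (square-nonNegative c₁) h₁)}} h₂ ⟩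
      (a₁ ℤ.* b₁) ℤ.* (a₂ ℤ.* b₂)  ≡⟨ interchange a₁ b₁ a₂ b₂ ⟩
      (a₁ ℤ.* a₂) ℤ.* (b₁ ℤ.* b₂)  ∎
      where open ℤ.≤-Reasoning

  private
    ∁++ : ∀ (A : Subset m) (B : Subset n) → ∁ (A ++ B) ≡ ∁ A ++ ∁ B
    ∁++ A B = map-++ not A B

  NoLoop-⊕ʳˡ : NoLoop ρ → NoLoop ρ₁
  NoLoop-⊕ʳˡ h e p = h (e ↑ˡ n) (trans (cong ρ (⁅↑ˡ⁆ e n)) (trans (⊕ʳ-++ ⁅ e ⁆ ⊥) (cong₂ _+_ p (bounded-⊥ b₂))))

  NoLoop-⊕ʳʳ : NoLoop ρ → NoLoop ρ₂
  NoLoop-⊕ʳʳ h e p = h (m ↑ʳ e) (trans (cong ρ (⁅↑ʳ⁆ m e)) (trans (⊕ʳ-++ ⊥ ⁅ e ⁆) (cong₂ _+_ (bounded-⊥ b₁) p)))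

  NoColoop-⊕ʳˡ : NoColoop ρ → NoColoop ρ₁
  NoColoop-⊕ʳˡ h e p = h (e ↑ˡ n) (subst₂ _<_
    (sym (trans (cong ρ (trans (cong ∁ (⁅↑ˡ⁆ e n)) (trans (∁++ ⁅ e ⁆ ⊥) (cong (∁ ⁅ e ⁆ ++_) ∁⊥≡⊤)))) (⊕ʳ-++ (∁ ⁅ e ⁆) ⊤)))
    (sym ⊕ʳ-⊤) (+-monoˡ-< (ρ₂ ⊤) p))

  NoColoop-⊕ʳʳ : NoColoop ρ → NoColoop ρ₂
  NoColoop-⊕ʳʳ h e p = h (m ↑ʳ e) (subst₂ _<_
    (sym (trans (cong ρ (trans (cong ∁ (⁅↑ʳ⁆ m e)) (trans (∁++ ⊥ ⁅ e ⁆) (cong (_++ ∁ ⁅ e ⁆) ∁⊥≡⊤)))) (⊕ʳ-++ ⊤ (∁ ⁅ e ⁆))))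
    (sym ⊕ʳ-⊤) (+-monoʳ-< (ρ₁ ⊤) p))

rankSum-bounded : ∀ L → Bounded (rankSum L)
rankSum-bounded List.[] = record { ≤-card = λ _ → z≤n ; ≤-top = λ _ → z≤n }
rankSum-bounded ((k , N) List.∷ L) = ⊕ʳ-bounded (matroid-bounded N) (rankSum-bounded L)

rankSum-MerinoWelsh : ∀ L → All (λ p → Uniform (proj₂ p)) L → NoLoop (rankSum L) → NoColoop (rankSum L) → MerinoWelsh (rankSum L)
rankSum-MerinoWelsh List.[] [] _ _ = ℤ.≤-refl
rankSum-MerinoWelsh ((k , N) List.∷ L) (uniform ∷ uniforms) noLoop noColoop = MerinoWelsh-⊕ʳ bN bL
  (elementarySplit⇒MerinoWelsh N (uniform⇒elementarySplit N uniform) (NoLoop-⊕ʳˡ bN bL noLoop) (NoColoop-⊕ʳˡ bN bL noColoop))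
  (rankSum-MerinoWelsh L uniforms (NoLoop-⊕ʳʳ bN bL noLoop) (NoColoop-⊕ʳʳ bN bL noColoop))
  where
  bN : Bounded (Matroid.rank N)
  bN = matroid-bounded N
  bL : Bounded (rankSum L)
  bL = rankSum-bounded L

-- Invariance under relabelling of the ground set

lookup-injective : ∀ {A B : Subset n} → (∀ i → lookup A i ≡ lookup B i) → A ≡ B
lookup-injective {A = A} {B} h = trans (sym (tabulate∘lookup A)) (trans (tabulate-cong h) (tabulate∘lookup B))

lookup-image : ∀ (σ : Fin n ↔ Fin m) A j → lookup (image σ A) j ≡ lookup A (σ ⟨$⟩ˡ j)
lookup-image σ A j = lookup∘tabulate _ j

-- Removing `zero` and its image from `σ` leaves a smaller bijection, and the bit `b` lands at the
-- image of `zero`. This permits induction on the size of the ground set for sums and cardinalities.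
image-∷ : ∀ (σ : Fin (suc n) ↔ Fin (suc m)) b A → image σ (b ∷ A) ≡ insertAt (image (remove zero σ) A) (σ ⟨$⟩ʳ zero) b
image-∷ σ b A = lookup-injective λ j → trans (lookup-image σ (b ∷ A) j) (at j)
  where
  i₀ : Fin _
  i₀ = σ ⟨$⟩ʳ zero
  σ′ : Permutation _ _
  σ′ = remove zero σ
  at-punchIn : ∀ j → lookup (b ∷ A) (σ ⟨$⟩ˡ punchIn i₀ j) ≡ lookup (insertAt (image σ′ A) i₀ b) (punchIn i₀ j)
  at-punchIn j = begin
    lookup (b ∷ A) (σ ⟨$⟩ˡ punchIn i₀ j)                           ≡⟨ cong (λ k → lookup (b ∷ A) (σ ⟨$⟩ˡ punchIn i₀ k)) (inverseʳ σ′) ⟨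
    lookup (b ∷ A) (σ ⟨$⟩ˡ punchIn i₀ (σ′ ⟨$⟩ʳ (σ′ ⟨$⟩ˡ j)))       ≡⟨ cong (λ k → lookup (b ∷ A) (σ ⟨$⟩ˡ k)) (punchIn-permute σ zero (σ′ ⟨$⟩ˡ j)) ⟨
    lookup (b ∷ A) (σ ⟨$⟩ˡ (σ ⟨$⟩ʳ suc (σ′ ⟨$⟩ˡ j)))               ≡⟨ cong (lookup (b ∷ A)) (inverseˡ σ) ⟩
    lookup A (σ′ ⟨$⟩ˡ j)                                           ≡⟨ lookup-image σ′ A j ⟨
    lookup (image σ′ A) j                                          ≡⟨ insertAt-punchIn (image σ′ A) i₀ b j ⟨
    lookup (insertAt (image σ′ A) i₀ b) (punchIn i₀ j)             ∎
    where open ≡-Reasoning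
  at : ∀ j → lookup (b ∷ A) (σ ⟨$⟩ˡ j) ≡ lookup (insertAt (image σ′ A) i₀ b) j
  at j with i₀ Fin.≟ j
  ... | yes refl = trans (cong (lookup (b ∷ A)) (inverseˡ σ)) (sym (insertAt-lookup (image σ′ A) i₀ b))
  ... | no i₀≢j = subst (λ k → lookup (b ∷ A) (σ ⟨$⟩ˡ k) ≡ lookup (insertAt (image σ′ A) i₀ b) k)
        (Fin.punchIn-punchOut i₀≢j) (at-punchIn (punchOut i₀≢j))

∑-insertAt : ∀ (i : Fin (suc n)) f → ∑ ⊥ ⊤ f ≡ ∑ ⊥ ⊤ (λ A → f (insertAt A i true)) ℤ.+ ∑ ⊥ ⊤ (λ A → f (insertAt A i false))
∑-insertAt zero f = refl
∑-insertAt {suc n} (suc i) f = trans (cong₂ ℤ._+_ (∑-insertAt i (f ∘ (true ∷_))) (∑-insertAt i (f ∘ (false ∷_))))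
  (interchange (∑ ⊥ ⊤ (λ A → f (true ∷ insertAt A i true))) _ (∑ ⊥ ⊤ (λ A → f (false ∷ insertAt A i true))) _)
  where
  interchange : ∀ a b c d → (a ℤ.+ b) ℤ.+ (c ℤ.+ d) ≡ (a ℤ.+ c) ℤ.+ (b ℤ.+ d)
  interchange = ℤ.solve-∀

∑-image : ∀ {n m} (σ : Fin n ↔ Fin m) f → ∑ ⊥ ⊤ (f ∘ image σ) ≡ ∑ ⊥ ⊤ f
∑-image {zero} {zero} σ f = refl
∑-image {zero} {suc m} σ f with () ← σ ⟨$⟩ˡ zero
∑-image {suc n} {zero} σ f with () ← σ ⟨$⟩ʳ zero
∑-image {suc n} {suc m} σ f = trans (cong₂ ℤ._+_ (half true) (half false)) (sym (∑-insertAt (σ ⟨$⟩ʳ zero) f))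
  where
  half : ∀ b → ∑ ⊥ ⊤ (λ A → f (image σ (b ∷ A))) ≡ ∑ ⊥ ⊤ (λ A → f (insertAt A (σ ⟨$⟩ʳ zero) b))
  half b = trans (∑-cong′ (λ A → cong f (image-∷ σ b A))) (∑-image (remove zero σ) (λ A → f (insertAt A (σ ⟨$⟩ʳ zero) b)))

∣insertAt∣ : ∀ (A : Subset n) i b → ∣ insertAt A i b ∣ ≡ ∣ b ∷ A ∣
∣insertAt∣ A zero b = refl
∣insertAt∣ (true ∷ A) (suc i) true = cong suc (∣insertAt∣ A i true)
∣insertAt∣ (true ∷ A) (suc i) false = cong suc (∣insertAt∣ A i false)
∣insertAt∣ (false ∷ A) (suc i) true = ∣insertAt∣ A i true
∣insertAt∣ (false ∷ A) (suc i) false = ∣insertAt∣ A i false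

∣image∣ : ∀ {n m} (σ : Fin n ↔ Fin m) A → ∣ image σ A ∣ ≡ ∣ A ∣
∣image∣ {zero} {zero} σ [] = refl
∣image∣ {zero} {suc m} σ A with () ← σ ⟨$⟩ˡ zero
∣image∣ {suc n} {zero} σ A with () ← σ ⟨$⟩ʳ zero
∣image∣ {suc n} {suc m} σ (b ∷ A) = trans (cong ∣_∣ (image-∷ σ b A))
  (trans (∣insertAt∣ (image (remove zero σ) A) (σ ⟨$⟩ʳ zero) b) (head b (image (remove zero σ) A) A (∣image∣ (remove zero σ) A)))
  where
  head : ∀ b (A : Subset m) (B : Subset n) → ∣ A ∣ ≡ ∣ B ∣ → ∣ b ∷ A ∣ ≡ ∣ b ∷ B ∣
  head true _ _ p = cong suc p
  head false _ _ p = p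

module _ (σ : Fin n ↔ Fin m) where
  image-⊤ : image σ ⊤ ≡ ⊤
  image-⊤ = lookup-injective λ j → trans (lookup-image σ ⊤ j)
    (trans (lookup-replicate (σ ⟨$⟩ˡ j) true) (sym (lookup-replicate j true)))

  image-∁ : ∀ A → image σ (∁ A) ≡ ∁ (image σ A)
  image-∁ A = lookup-injective λ j → begin
    lookup (image σ (∁ A)) j         ≡⟨ lookup-image σ (∁ A) j ⟩
    lookup (∁ A) (σ ⟨$⟩ˡ j)          ≡⟨ lookup-map (σ ⟨$⟩ˡ j) not A ⟩
    not (lookup A (σ ⟨$⟩ˡ j))        ≡⟨ cong not (lookup-image σ A j) ⟨
    not (lookup (image σ A) j)       ≡⟨ lookup-map j not (image σ A) ⟨
    lookup (∁ (image σ A)) j         ∎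
    where open ≡-Reasoning

  image-⁅⁆ : ∀ j → image σ ⁅ σ ⟨$⟩ˡ j ⁆ ≡ ⁅ j ⁆
  image-⁅⁆ j = ⊆-antisym to from
    where
    to : image σ ⁅ σ ⟨$⟩ˡ j ⁆ ⊆ ⁅ j ⁆
    to {i} i∈ = subst (_∈ ⁅ j ⁆) (sym (trans (sym (inverseʳ σ)) (trans (cong (σ ⟨$⟩ʳ_) same) (inverseʳ σ)))) (x∈⁅x⁆ j)
      where
      same : σ ⟨$⟩ˡ i ≡ σ ⟨$⟩ˡ j
      same = x∈⁅y⁆⇒x≡y (σ ⟨$⟩ˡ j) (lookup⇒[]= _ ⁅ σ ⟨$⟩ˡ j ⁆ (trans (sym (lookup-image σ ⁅ σ ⟨$⟩ˡ j ⁆ i)) ([]=⇒lookup i∈)))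
    from : ⁅ j ⁆ ⊆ image σ ⁅ σ ⟨$⟩ˡ j ⁆
    from {i} i∈ with refl ← x∈⁅y⁆⇒x≡y j i∈ = lookup⇒[]= i _ (trans (lookup-image σ ⁅ σ ⟨$⟩ˡ i ⁆ i) ([]=⇒lookup (x∈⁅x⁆ (σ ⟨$⟩ˡ i))))

module _ (M : Matroid n) (ρ : RankFn m) (σ : Fin n ↔ Fin m) (iso : ∀ A → Matroid.rank M A ≡ ρ (image σ A)) where
  open Matroid M using (rank)

  rankTutte-≅ʳ : ∀ u v → rankTutte rank u v ≡ rankTutte ρ u v
  rankTutte-≅ʳ u v = trans (∑-cong′ λ A → cong₂ (λ p q → u ℤ.^ p ℤ.* v ℤ.^ q)
      (cong₂ _∸_ (trans (iso ⊤) (cong ρ (image-⊤ σ))) (iso A)) (cong₂ _∸_ (sym (∣image∣ σ A)) (iso A)))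
    (∑-image σ (rankTerm ρ u v))

  NoLoop-≅ʳ : NoLoop rank → NoLoop ρ
  NoLoop-≅ʳ h j p = h (σ ⟨$⟩ˡ j) (trans (iso _) (trans (cong ρ (image-⁅⁆ σ j)) p))

  NoColoop-≅ʳ : NoColoop rank → NoColoop ρ
  NoColoop-≅ʳ h j p = h (σ ⟨$⟩ˡ j) (subst₂ _<_
    (sym (trans (iso _) (cong ρ (trans (image-∁ σ ⁅ σ ⟨$⟩ˡ j ⁆) (cong ∁ (image-⁅⁆ σ j))))))
    (sym (trans (iso ⊤) (cong ρ (image-⊤ σ)))) p)

theorem1p3 : ∀ {n : ℕ} (M : Matroid n) → IsSplit M →
    (∀ e → ¬ Loop M e) → (∀ e → ¬ Coloop M e) →
    tutte M (ℤ.+ 1) (ℤ.+ 1) ℤ.* tutte M (ℤ.+ 1) (ℤ.+ 1) ℤ.≤ tutte M (ℤ.+ 2) (ℤ.+ 0) ℤ.* tutte M (ℤ.+ 0) (ℤ.+ 2)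
theorem1p3 M (m , N , split , L , uniforms , σ , iso) noLoop noColoop = subst₂ ℤ._≤_
  (sym (cong₂ ℤ._*_ (eval (ℤ.+ 1) (ℤ.+ 1)) (eval (ℤ.+ 1) (ℤ.+ 1))))
  (sym (cong₂ ℤ._*_ (eval (ℤ.+ 2) (ℤ.+ 0)) (eval (ℤ.+ 0) (ℤ.+ 2))))
  (MerinoWelsh-⊕ʳ bN bL
    (elementarySplit⇒MerinoWelsh N (connectedSplit⇒elementarySplit N split) (NoLoop-⊕ʳˡ bN bL noLoop′) (NoColoop-⊕ʳˡ bN bL noColoop′))
    (rankSum-MerinoWelsh L uniforms (NoLoop-⊕ʳʳ bN bL noLoop′) (NoColoop-⊕ʳʳ bN bL noColoop′)))
  where
  ρ : RankFn (m + size L)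
  ρ = Matroid.rank N ⊕ʳ rankSum L
  bN : Bounded (Matroid.rank N)
  bN = matroid-bounded N
  bL : Bounded (rankSum L)
  bL = rankSum-bounded L
  noLoop′ : NoLoop ρ
  noLoop′ = NoLoop-≅ʳ M ρ σ iso noLoop
  noColoop′ : NoColoop ρ
  noColoop′ = NoColoop-≅ʳ M ρ σ iso noColoop
  eval : ∀ x y → tutte M x y ≡ rankTutte ρ (x ℤ.- 1ℤ) (y ℤ.- 1ℤ)
  eval x y = trans (tutte≡rankTutte M x y) (rankTutte-≅ʳ M ρ σ iso _ _)
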